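{- Let $n\ge 2$ be a fixed integer and let $$ P(x_1, x_2, \ldots, x_{n+2})=\sum_{i=1}^{n} (x_2-x_1)^{i-1} x_1^{n-i} x_{i+2}. $$ Then there is a constant $c>0$, depending only on $n$, such that for any finite set $A\subset \mathbb{C}$ we have $$ \Bigl|\bigl\{P(x_1,x_2,\ldots,x_{n+2}): \, x_1,\ldots,x_{n+2}\in A\bigr\}\Bigr|\ge c\,|A|^{n}. $$
   Context: $|X|$ denotes the cardinality of a finite set $X$. $P$ is a polynomial in the variables $x_1,\dots,x_{n+2}$ (so zeroth powers are the constant $1$). The variables $x_1,\ldots,x_{n+2}$ range independently over $A$ (repetitions allowed). -}

module Defs where

open import Level using (0ℓ) renaming (_⊔_ to _⊔ˡ_)
open import Algebra.Bundles using (RawRing)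
import Algebra.Definitions.RawSemiring as RawSemiringDefinitions
open import Data.Fin.Base using (Fin; toℕ) renaming (zero to fzero; suc to fsuc)
open import Data.Integer.Base using (+_)
open import Data.List.Base using (List; length)
import Data.List.Membership.Setoid as Membership
import Data.List.Relation.Unary.Unique.Setoid as UniqueSetoid
open import Data.Nat.Base as ℕ using (ℕ; _∸_)
import Data.Nat.Properties as ℕₚ
open import Data.Product.Base using (_×_; _,_; ∃)
open import Data.Rational.Base
open import Data.Rational.Properties
open import Data.Rational.Solver using (module +-*-Solver)
open import Data.Vec.Functional using (Vector)
open import Function.Bundles using (_⇔_)
open import Relation.Binary.Bundles using (Setoid)
open import Relation.Binary.PropositionalEquality
  using (_≡_; refl; sym; trans; cong; subst)
open import Relation.Unary using (Pred)

open +-*-Solver using (solve; _:+_; _:*_; :-_; _:-_; _:=_; con)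

-- Real numbers are all Cauchy sequences of rationals (no fixed modulus); the
-- quotient by null sequences is replaced by the setoid equality _≈ᴿ_.

Cauchy : (ℕ → ℚ) → Set
Cauchy s = ∀ ε → 0ℚ < ε →
  ∃ λ N → ∀ m n → N ℕ.≤ m → N ℕ.≤ n → ∣ s m - s n ∣ < ε

record ℝ : Set where
  constructor mkℝ
  field
    seq    : ℕ → ℚ
    cauchy : Cauchy seq

open ℝ public

infix 4 _≈ᴿ_

record _≈ᴿ_ (x y : ℝ) : Set where
  constructor mk≈ᴿ
  field
    close : ∀ ε → 0ℚ < ε →
      ∃ λ N → ∀ n → N ℕ.≤ n → ∣ seq x n - seq y n ∣ < ε

open _≈ᴿ_ public

½ε+½ε≡ε : ∀ ε → ½ * ε + ½ * ε ≡ ε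
½ε+½ε≡ε = solve 1 (λ e → con ½ :* e :+ con ½ :* e := e) refl

*-pos : ∀ {p q} → 0ℚ < p → 0ℚ < q → 0ℚ < p * q
*-pos {p} {q} 0<p 0<q =
  positive⁻¹ (p * q) {{pos*pos⇒pos p {{positive 0<p}} q {{positive 0<q}}}}

half-pos : ∀ {ε} → 0ℚ < ε → 0ℚ < ½ * ε
half-pos = *-pos (positive⁻¹ ½)

abs-split : ∀ {p} q r {δ} ε → p ≡ q + r → δ ≡ ½ * ε →
            ∣ q ∣ < δ → ∣ r ∣ < δ → ∣ p ∣ < ε
abs-split q r ε refl refl q<δ r<δ =
  ≤-<-trans (∣p+q∣≤∣p∣+∣q∣ q r)
    (subst (∣ q ∣ + ∣ r ∣ <_) (½ε+½ε≡ε ε) (+-mono-< q<δ r<δ))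

∣p-p∣<ε : ∀ p {ε} → 0ℚ < ε → ∣ p - p ∣ < ε
∣p-p∣<ε p {ε} = subst (λ z → ∣ z ∣ < ε) (sym (+-inverseʳ p))

∣p-q∣≡∣q-p∣ : ∀ p q → ∣ p - q ∣ ≡ ∣ q - p ∣
∣p-q∣≡∣q-p∣ p q = trans
  (cong ∣_∣ (solve 2 (λ a b → a :- b := :- (b :- a)) refl p q))
  (∣-p∣≡∣p∣ (q - p))

eventually-bounded : ∀ x → ∃ λ B → ∃ λ N →
  0ℚ < B × (∀ n → N ℕ.≤ n → ∣ seq x n ∣ < B)
eventually-bounded x with cauchy x 1ℚ (positive⁻¹ 1ℚ)
... | N , near = 1ℚ + ∣ c ∣ , N , 0<B , bound
  where
  c : ℚ
  c = seq x N

  0<B : 0ℚ < 1ℚ + ∣ c ∣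
  0<B = +-mono-<-≤ (positive⁻¹ 1ℚ) (0≤∣p∣ c)

  bound : ∀ n → N ℕ.≤ n → ∣ seq x n ∣ < 1ℚ + ∣ c ∣
  bound n N≤n = ≤-<-trans
    (subst (λ z → ∣ z ∣ ≤ ∣ seq x n - c ∣ + ∣ c ∣)
      (solve 2 (λ a b → (a :- b) :+ b := a) refl (seq x n) c)
      (∣p+q∣≤∣p∣+∣q∣ (seq x n - c) c))
    (+-monoˡ-< ∣ c ∣ (near n N N≤n ℕₚ.≤-refl))

scaled-pos : ∀ {B ε} → 0ℚ < B → 0ℚ < ε → ∃ λ δ → 0ℚ < δ × B * δ ≡ ½ * ε
scaled-pos {B} {ε} 0<B 0<ε =
  B⁻¹ * (½ * ε) , *-pos 0<B⁻¹ (half-pos 0<ε) ,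
  trans (sym (*-assoc B B⁻¹ (½ * ε)))
    (trans (cong (_* (½ * ε)) (*-inverseʳ B)) (*-identityˡ (½ * ε)))
  where
  instance
    B-pos : Positive B
    B-pos = positive 0<B
    B-nonZero : NonZero B
    B-nonZero = pos⇒nonZero B
  B⁻¹ : ℚ
  B⁻¹ = 1/ B
  0<B⁻¹ : 0ℚ < B⁻¹
  0<B⁻¹ = positive⁻¹ B⁻¹ {{1/pos⇒pos B}}

abs-*-< : ∀ a {b B δ} → 0ℚ < B → ∣ a ∣ < B → ∣ b ∣ < δ → ∣ a * b ∣ < B * δ
abs-*-< a {b} {B} {δ} 0<B a<B b<δ = subst (_< B * δ) (sym (∣p*q∣≡∣p∣*∣q∣ a b))
  (≤-<-trans
    (*-monoʳ-≤-nonNeg ∣ b ∣ {{∣-∣-nonNeg b}} (<⇒≤ a<B))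
    (*-monoʳ-<-pos B {{positive 0<B}} b<δ))

+-cauchy : ∀ x y → Cauchy (λ n → seq x n + seq y n)
+-cauchy x y ε 0<ε =
  let N₁ , p = cauchy x (½ * ε) (half-pos 0<ε)
      N₂ , q = cauchy y (½ * ε) (half-pos 0<ε)
  in N₁ ℕ.⊔ N₂ , λ m n N≤m N≤n → abs-split _ _ ε
       (solve 4 (λ a b c d → (a :+ b) :- (c :+ d) := (a :- c) :+ (b :- d))
         refl (seq x m) (seq y m) (seq x n) (seq y n))
       refl
       (p m n (ℕₚ.m⊔n≤o⇒m≤o N₁ N₂ N≤m) (ℕₚ.m⊔n≤o⇒m≤o N₁ N₂ N≤n))
       (q m n (ℕₚ.m⊔n≤o⇒n≤o N₁ N₂ N≤m) (ℕₚ.m⊔n≤o⇒n≤o N₁ N₂ N≤n))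

neg-cauchy : ∀ x → Cauchy (λ n → - seq x n)
neg-cauchy x ε 0<ε =
  let N , p = cauchy x ε 0<ε
  in N , λ m n N≤m N≤n → subst (_< ε)
       (cong ∣_∣ (solve 2 (λ a b → b :- a := (:- a) :- (:- b)) refl
         (seq x m) (seq x n)))
       (p n m N≤n N≤m)

*-cauchy : ∀ x y → Cauchy (λ n → seq x n * seq y n)
*-cauchy x y ε 0<ε =
  let B , M₁ , 0<B , x<B = eventually-bounded x
      C , M₂ , 0<C , y<C = eventually-bounded y
      δ , 0<δ , Bδ = scaled-pos 0<B 0<ε
      γ , 0<γ , Cγ = scaled-pos 0<C 0<ε
      N₁ , p = cauchy x γ 0<γ
      N₂ , q = cauchy y δ 0<δ
      M = M₁ ℕ.⊔ M₂
      N = N₁ ℕ.⊔ N₂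
      M≤ = λ k (h : M ℕ.⊔ N ℕ.≤ k) → ℕₚ.m⊔n≤o⇒m≤o M N h
      N≤ = λ k (h : M ℕ.⊔ N ℕ.≤ k) → ℕₚ.m⊔n≤o⇒n≤o M N h
  in M ℕ.⊔ N , λ m n hm hn → abs-split _ _ ε
       (solve 4 (λ a b c d →
           a :* b :- c :* d := a :* (b :- d) :+ d :* (a :- c))
         refl (seq x m) (seq y m) (seq x n) (seq y n))
       refl
       (subst (∣ seq x m * (seq y m - seq y n) ∣ <_) Bδ
         (abs-*-< (seq x m) 0<B (x<B m (ℕₚ.m⊔n≤o⇒m≤o M₁ M₂ (M≤ m hm)))
           (q m n (ℕₚ.m⊔n≤o⇒n≤o N₁ N₂ (N≤ m hm))
                  (ℕₚ.m⊔n≤o⇒n≤o N₁ N₂ (N≤ n hn)))))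
       (subst (∣ seq y n * (seq x m - seq x n) ∣ <_) Cγ
         (abs-*-< (seq y n) 0<C (y<C n (ℕₚ.m⊔n≤o⇒n≤o M₁ M₂ (M≤ n hn)))
           (p m n (ℕₚ.m⊔n≤o⇒m≤o N₁ N₂ (N≤ m hm))
                  (ℕₚ.m⊔n≤o⇒m≤o N₁ N₂ (N≤ n hn)))))

≈ᴿ-refl : ∀ {x} → x ≈ᴿ x
≈ᴿ-refl {x} .close ε 0<ε = 0 , λ n _ → ∣p-p∣<ε (seq x n) 0<ε

≈ᴿ-sym : ∀ {x y} → x ≈ᴿ y → y ≈ᴿ x
≈ᴿ-sym {x} {y} x≈y .close ε 0<ε =
  let N , p = close x≈y ε 0<ε
  in N , λ n N≤n → subst (_< ε) (∣p-q∣≡∣q-p∣ (seq x n) (seq y n)) (p n N≤n)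

≈ᴿ-trans : ∀ {x y z} → x ≈ᴿ y → y ≈ᴿ z → x ≈ᴿ z
≈ᴿ-trans {x} {y} {z} x≈y y≈z .close ε 0<ε =
  let N₁ , p = close x≈y (½ * ε) (half-pos 0<ε)
      N₂ , q = close y≈z (½ * ε) (half-pos 0<ε)
  in N₁ ℕ.⊔ N₂ , λ n N≤n → abs-split _ _ ε
       (solve 3 (λ a b c → a :- c := (a :- b) :+ (b :- c)) refl
         (seq x n) (seq y n) (seq z n))
       refl
       (p n (ℕₚ.m⊔n≤o⇒m≤o N₁ N₂ N≤n))
       (q n (ℕₚ.m⊔n≤o⇒n≤o N₁ N₂ N≤n))

infixl 6 _+ᴿ_
infixl 7 _*ᴿ_
infix  8 -ᴿ_

fromℚ : ℚ → ℝ
fromℚ q = mkℝ (λ _ → q) λ ε 0<ε → 0 , λ _ _ _ _ → ∣p-p∣<ε q 0<ε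

_+ᴿ_ : ℝ → ℝ → ℝ
x +ᴿ y = mkℝ (λ n → seq x n + seq y n) (+-cauchy x y)

-ᴿ_ : ℝ → ℝ
-ᴿ x = mkℝ (λ n → - seq x n) (neg-cauchy x)

_*ᴿ_ : ℝ → ℝ → ℝ
x *ᴿ y = mkℝ (λ n → seq x n * seq y n) (*-cauchy x y)

record ℂ : Set where
  constructor _+i_
  field
    re : ℝ
    im : ℝ

open ℂ public

infix 4 _≈ᶜ_

record _≈ᶜ_ (z w : ℂ) : Set where
  constructor mk≈ᶜ
  field
    re-≈ : re z ≈ᴿ re w
    im-≈ : im z ≈ᴿ im w

open _≈ᶜ_ public

ℂ-setoid : Setoid 0ℓ 0ℓ
ℂ-setoid = record
  { Carrier       = ℂ
  ; _≈_           = _≈ᶜ_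
  ; isEquivalence = record
    { refl  = mk≈ᶜ ≈ᴿ-refl ≈ᴿ-refl
    ; sym   = λ p → mk≈ᶜ (≈ᴿ-sym (re-≈ p)) (≈ᴿ-sym (im-≈ p))
    ; trans = λ p q → mk≈ᶜ (≈ᴿ-trans (re-≈ p) (re-≈ q))
                           (≈ᴿ-trans (im-≈ p) (im-≈ q))
    }
  }

ℂ-rawRing : RawRing 0ℓ 0ℓ
ℂ-rawRing = record
  { Carrier = ℂ
  ; _≈_     = _≈ᶜ_
  ; _+_     = λ z w → (re z +ᴿ re w) +i (im z +ᴿ im w)
  ; _*_     = λ z w → (re z *ᴿ re w +ᴿ -ᴿ (im z *ᴿ im w))
                   +i (re z *ᴿ im w +ᴿ im z *ᴿ re w)
  ; -_      = λ z → (-ᴿ re z) +i (-ᴿ im z)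
  ; 0#      = fromℚ 0ℚ +i fromℚ 0ℚ
  ; 1#      = fromℚ 1ℚ +i fromℚ 0ℚ
  }

-- ∣ X ∣ = k.  Membership is up to the setoid equality, so this also forces X
-- to be finite and closed under that equality.

module _ {a ℓ} (S : Setoid a ℓ) where
  open Setoid S using (Carrier)
  open Membership S using (_∈_)
  open UniqueSetoid S using (Unique)

  HasCardinality : ∀ {p} → Pred Carrier p → ℕ → Set (a ⊔ˡ ℓ ⊔ˡ p)
  HasCardinality X k =
    ∃ λ (xs : List Carrier) →
      Unique xs × length xs ≡ k × (∀ z → X z ⇔ z ∈ xs)

-- The index i : Fin n is zero-based, so it stands for the summation
-- index 1 + toℕ i; likewise the variables are x 0 , … , x (n + 1).

module _ {a ℓ} (R : RawRing a ℓ) where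
  open RawRing R using (Carrier; rawSemiring)
    renaming (_+_ to _⊕_; _*_ to _⊗_; -_ to ⊖_)
  open RawSemiringDefinitions rawSemiring using (sum) renaming (_^_ to _↑_)

  P : ∀ n → Vector Carrier (2 ℕ.+ n) → Carrier
  P n x = sum λ (i : Fin n) →
    (((x₂ ⊕ (⊖ x₁)) ↑ toℕ i) ⊗ (x₁ ↑ (n ∸ ℕ.suc (toℕ i)))) ⊗ x (fsuc (fsuc i))
    where
    x₁ x₂ : Carrier
    x₁ = x fzero
    x₂ = x (fsuc fzero)

Values : ∀ n → Pred ℂ 0ℓ → Pred ℂ 0ℓ
Values n A z =
  ∃ λ (x : Vector ℂ (2 ℕ.+ n)) → (∀ j → A (x j)) × z ≈ᶜ P ℂ-rawRing n x

ℕ→ℚ : ℕ → ℚ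
ℕ→ℚ k = + k / 1

{-# OPTIONS --safe #-}

-- Write u = x₂ - x₁, v = x₁.  Then P = Σ uⁱ vⁿ⁻¹⁻ⁱ yᵢ is, up to the factor vⁿ⁻¹,
-- an expansion in base u / v with digits yᵢ.  Choose x₁ ≠ x₂ in A with
-- ‖ x₂ ‖ ≤ ‖ x₁ ‖ and ‖ u ‖ / ‖ v ‖ minimal, order A by decreasing norm and cut it
-- into n blocks of equal size.  By minimality, x and y in one block differ by at
-- least (‖ u ‖ / ‖ v ‖) r, where r bounds the norm of all later blocks.  After
-- thinning each block by a constant factor (a colour class of a square grid) the
-- first digit in which two expansions differ dominates the remaining ones, so
-- that all expansions with i-th digit in block i have distinct values.
--
-- The selection is made in ℚ[i], at one index of the Cauchy sequences.  It keeps
-- the values apart by a bound that does not depend on the index, so an index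
-- late enough for that bound makes the complex values distinct as well.
module Submission where

open import Defs
open import Algebra.Bundles using (RawRing)
import Algebra.Definitions.RawSemiring as RawSemiringDefinitions
open import Data.Empty using (⊥-elim)
open import Data.Fin.Base using (toℕ) renaming (zero to fzero; suc to fsuc)
import Data.Fin.Properties as Finₚ
open import Data.Integer.Base as ℤ using (ℤ; +_)
import Data.Integer.DivMod as ℤᵈ
import Data.Integer.Properties as ℤₚ
open import Data.List.Base as List
  using (List; []; _∷_; _++_; length; map; cartesianProductWith)
open import Data.List.Membership.Propositional using (_∈_; find)
open import Data.List.Membership.Propositional.Properties
  using (∈-map⁺; ∈-map⁻; ∈-lookup; ∈-cartesianProductWith⁺)
import Data.List.Membership.Setoid as Membership
import Data.List.Membership.Setoid.Properties as Membershipₚ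
open import Data.List.Properties using (length-++; length-map)
open import Data.List.Relation.Binary.Permutation.Propositional using (↭⇒↭ₛ; ↭-sym)
import Data.List.Relation.Binary.Permutation.Propositional.Properties as Permutationₚ
import Data.List.Relation.Binary.Permutation.Setoid.Properties as Permutation
open import Data.List.Relation.Binary.Sublist.Propositional
  using (_⊆_; []; _∷_; _∷ʳ_; ⊆-trans)
open import Data.List.Relation.Binary.Sublist.Propositional.Properties using (All-resp-⊆)
open import Data.List.Relation.Unary.All as All using (All; []; _∷_)
import Data.List.Relation.Unary.All.Properties as Allₚ
open import Data.List.Relation.Unary.AllPairs as AllPairs using (AllPairs; []; _∷_)
import Data.List.Relation.Unary.AllPairs.Properties as AllPairsₚ
open import Data.List.Relation.Unary.Any as Any using (here; there)
open import Data.List.Relation.Unary.Linked.Properties using (Linked⇒AllPairs)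
import Data.List.Relation.Unary.Unique.Setoid as UniqueSetoid
open import Data.List.Sort using (sort; sort-↭; sort-↗)
open import Data.Nat.Base as ℕ using (ℕ; zero; suc; _∸_)
open import Data.Nat.DivMod using (m≡m%n+[m/n]*n; m%n<n)
import Data.Nat.Properties as ℕₚ
open import Data.Product.Base using (∃; _×_; _,_; proj₁; proj₂)
open import Data.Rational.Base
  using (ℚ; 0ℚ; 1ℚ; ½; _<_; _≤_; _*_; _+_; _-_; -_; 1/_; _/_; ∣_∣; _⊓_; _⊔_; floor; mkℚ;
         toℚᵘ; ↥_; ↧_; NonZero; Positive; ≢-nonZero; nonNegative; positive)
open import Data.Rational.Properties
open import Data.Rational.Solver using (module +-*-Solver)
import Data.Rational.Unnormalised.Base as ℚᵘ
import Data.Rational.Unnormalised.Properties as ℚᵘₚ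
open import Data.Sum.Base using (_⊎_; inj₁; inj₂)
open import Data.Vec.Base as Vec using (Vec; []; _∷_)
open import Data.Vec.Functional using (Vector)
open import Data.Vec.Properties using (lookup-map; lookup∘tabulate)
import Data.Vec.Relation.Unary.All as VecAll
import Data.Vec.Relation.Unary.All.Properties as VecAllₚ
open import Function.Base using (_∘_; case_of_)
open import Function.Bundles using (_⇔_; mk⇔; Equivalence)
open import Function.Construct.Composition using (_⇔-∘_)
open import Level using (0ℓ)
open import Relation.Binary.Bundles using (DecTotalOrder; Setoid)
import Relation.Binary.Construct.Flip.EqAndOrd as Flip
import Relation.Binary.Construct.On as On
open import Relation.Binary.Core using (Rel)
open import Relation.Binary.Definitions using (Symmetric; Tri; tri<; tri≈; tri>)
open import Relation.Binary.PropositionalEquality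
  using (_≡_; refl; sym; trans; cong; cong₂; subst; subst₂; setoid; resp₂)
open import Relation.Nullary using (¬_; Dec; yes; no; contradiction)
open import Relation.Nullary.Decidable using (from-yes; ¬¬-excluded-middle)
open import Relation.Unary using (Pred)

open +-*-Solver using (solve; _:+_; _:*_; :-_; _:-_; _:=_; con)

-- Order and squares in ℚ.

*-nonneg : ∀ {p q} → 0ℚ ≤ p → 0ℚ ≤ q → 0ℚ ≤ p * q
*-nonneg {p} {q} 0≤p 0≤q =
  nonNegative⁻¹ (p * q) {{nonNeg*nonNeg⇒nonNeg p {{nonNegative 0≤p}} q {{nonNegative 0≤q}}}}

+-nonneg : ∀ {p q} → 0ℚ ≤ p → 0ℚ ≤ q → 0ℚ ≤ p + q
+-nonneg = +-mono-≤

*-monoˡ-≤ : ∀ {p q r} → 0ℚ ≤ r → p ≤ q → r * p ≤ r * q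
*-monoˡ-≤ {r = r} 0≤r = *-monoˡ-≤-nonNeg r {{nonNegative 0≤r}}

*-monoʳ-≤ : ∀ {p q r} → 0ℚ ≤ r → p ≤ q → p * r ≤ q * r
*-monoʳ-≤ {r = r} 0≤r = *-monoʳ-≤-nonNeg r {{nonNegative 0≤r}}

*-mono-≤ : ∀ {p q r s} → 0ℚ ≤ q → 0ℚ ≤ r → p ≤ q → r ≤ s → p * r ≤ q * s
*-mono-≤ 0≤q 0≤r p≤q r≤s = ≤-trans (*-monoʳ-≤ 0≤r p≤q) (*-monoˡ-≤ 0≤q r≤s)

*-cancelˡ-≤ : ∀ {p q r} → 0ℚ < r → r * p ≤ r * q → p ≤ q
*-cancelˡ-≤ {r = r} 0<r = *-cancelˡ-≤-pos r {{positive 0<r}}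

square-nonneg : ∀ p → 0ℚ ≤ p * p
square-nonneg p with ∣p∣≡p∨∣p∣≡-p p
... | inj₁ eq = *-nonneg (∣p∣≡p⇒0≤p eq) (∣p∣≡p⇒0≤p eq)
... | inj₂ eq = subst (0ℚ ≤_)
  (solve 1 (λ a → (:- a) :* (:- a) := a :* a) refl p) (*-nonneg 0≤-p 0≤-p)
  where
  0≤-p : 0ℚ ≤ - p
  0≤-p = subst (0ℚ ≤_) eq (0≤∣p∣ p)

square-mono : ∀ {p q} → 0ℚ ≤ p → p ≤ q → p * p ≤ q * q
square-mono 0≤p p≤q = *-mono-≤ (≤-trans 0≤p p≤q) 0≤p p≤q p≤q

∣p∣*∣p∣≡p*p : ∀ p → ∣ p ∣ * ∣ p ∣ ≡ p * p
∣p∣*∣p∣≡p*p p = trans (sym (∣p*q∣≡∣p∣*∣q∣ p p)) (0≤p⇒∣p∣≡p (square-nonneg p))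

-- Gaussian rationals.

-- The operations are those of ℂ-rawRing performed at one index of the Cauchy
-- sequences, so that evaluation at an index is a homomorphism definitionally.

ℚ[i] : Set
ℚ[i] = ℚ × ℚ

infixl 6 _⊕_ _⊝_
infixl 7 _⊗_

_⊕_ _⊗_ _⊝_ : ℚ[i] → ℚ[i] → ℚ[i]
(a , b) ⊕ (c , d) = a + c , b + d
(a , b) ⊗ (c , d) = a * c + - (b * d) , a * d + b * c
(a , b) ⊝ (c , d) = a + - c , b + - d

ℚ[i]-rawRing : RawRing 0ℓ 0ℓ
ℚ[i]-rawRing = record
  { Carrier = ℚ[i]
  ; _≈_     = _≡_
  ; _+_     = _⊕_
  ; _*_     = _⊗_
  ; -_      = λ { (a , b) → - a , - b }
  ; 0#      = 0ℚ , 0ℚ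
  ; 1#      = 1ℚ , 0ℚ
  }

⊗-assoc : ∀ x y z → (x ⊗ y) ⊗ z ≡ x ⊗ (y ⊗ z)
⊗-assoc (a , b) (c , d) (e , f) = cong₂ _,_
  (solve 6 (λ a b c d e f →
      (a :* c :+ :- (b :* d)) :* e :+ :- ((a :* d :+ b :* c) :* f)
      := a :* (c :* e :+ :- (d :* f)) :+ :- (b :* (c :* f :+ d :* e)))
    refl a b c d e f)
  (solve 6 (λ a b c d e f →
      (a :* c :+ :- (b :* d)) :* f :+ (a :* d :+ b :* c) :* e
      := a :* (c :* f :+ d :* e) :+ b :* (c :* e :+ :- (d :* f)))
    refl a b c d e f)

⊗-distribˡ-⊕ : ∀ x y z → x ⊗ (y ⊕ z) ≡ (x ⊗ y) ⊕ (x ⊗ z)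
⊗-distribˡ-⊕ (a , b) (c , d) (e , f) = cong₂ _,_
  (solve 6 (λ a b c d e f →
      a :* (c :+ e) :+ :- (b :* (d :+ f))
      := (a :* c :+ :- (b :* d)) :+ (a :* e :+ :- (b :* f)))
    refl a b c d e f)
  (solve 6 (λ a b c d e f →
      a :* (d :+ f) :+ b :* (c :+ e)
      := (a :* d :+ b :* c) :+ (a :* f :+ b :* e))
    refl a b c d e f)

⊗-identityˡ : ∀ x → (1ℚ , 0ℚ) ⊗ x ≡ x
⊗-identityˡ (a , b) = cong₂ _,_
  (solve 2 (λ a b → con 1ℚ :* a :+ :- (con 0ℚ :* b) := a) refl a b)
  (solve 2 (λ a b → con 1ℚ :* b :+ con 0ℚ :* a := b) refl a b)

⊗-zeroʳ : ∀ x → x ⊗ (0ℚ , 0ℚ) ≡ (0ℚ , 0ℚ)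
⊗-zeroʳ (a , b) = cong₂ _,_
  (solve 2 (λ a b → a :* con 0ℚ :+ :- (b :* con 0ℚ) := con 0ℚ) refl a b)
  (solve 2 (λ a b → a :* con 0ℚ :+ b :* con 0ℚ := con 0ℚ) refl a b)

-- Squared Euclidean norm and sup norm.

-- Multiplicative, unlike the sup norm ‖_‖.
norm² : ℚ[i] → ℚ
norm² (a , b) = a * a + b * b

-- The root of `norm²` may be irrational. The sup norm stays in ℚ, satisfies the triangle
-- inequality, and its square agrees with `norm²` up to a factor 2.
‖_‖ : ℚ[i] → ℚ
‖ a , b ‖ = ∣ a ∣ ⊔ ∣ b ∣

2ℚ 4ℚ 8ℚ : ℚ
2ℚ = + 2 / 1
4ℚ = + 4 / 1
8ℚ = + 8 / 1

norm²-nonneg : ∀ z → 0ℚ ≤ norm² z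
norm²-nonneg (a , b) = +-nonneg (square-nonneg a) (square-nonneg b)

norm²-⊗ : ∀ z w → norm² (z ⊗ w) ≡ norm² z * norm² w
norm²-⊗ (a , b) (c , d) = solve 4 (λ a b c d →
    (a :* c :+ :- (b :* d)) :* (a :* c :+ :- (b :* d))
      :+ (a :* d :+ b :* c) :* (a :* d :+ b :* c)
    := (a :* a :+ b :* b) :* (c :* c :+ d :* d))
  refl a b c d

x≤x+y : ∀ {x y} → 0ℚ ≤ y → x ≤ x + y
x≤x+y {x} {y} 0≤y = subst (_≤ x + y) (+-identityʳ x) (+-monoʳ-≤ x 0≤y)

-- By the parallelogram law.
norm²-⊕ : ∀ z w → norm² (z ⊕ w) ≤ 2ℚ * (norm² z + norm² w)
norm²-⊕ z@(a , b) w@(c , d) = subst (norm² (z ⊕ w) ≤_)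
  (solve 4 (λ a b c d →
      ((a :+ c) :* (a :+ c) :+ (b :+ d) :* (b :+ d))
        :+ ((a :+ :- c) :* (a :+ :- c) :+ (b :+ :- d) :* (b :+ :- d))
      := con 2ℚ :* ((a :* a :+ b :* b) :+ (c :* c :+ d :* d)))
    refl a b c d)
  (x≤x+y (norm²-nonneg (z ⊝ w)))

norm²-⊝ : ∀ z w → norm² (z ⊝ w) ≤ 2ℚ * (norm² z + norm² w)
norm²-⊝ z@(a , b) w@(c , d) = subst (norm² (z ⊝ w) ≤_)
  (solve 4 (λ a b c d →
      ((a :+ :- c) :* (a :+ :- c) :+ (b :+ :- d) :* (b :+ :- d))
        :+ ((a :+ c) :* (a :+ c) :+ (b :+ d) :* (b :+ d))
      := con 2ℚ :* ((a :* a :+ b :* b) :+ (c :* c :+ d :* d)))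
    refl a b c d)
  (x≤x+y (norm²-nonneg (z ⊕ w)))

-- norm² z = norm² ((z ⊕ w) ⊝ w) ≤ 2 norm² (z ⊕ w) + 2 norm² w, and 4 norm² w ≤ norm² z.
norm²-dominant : ∀ z w → 4ℚ * norm² w ≤ norm² z → norm² z ≤ 4ℚ * norm² (z ⊕ w)
norm²-dominant z@(a , b) w@(c , d) 4w≤z =
  subst₂ _≤_
    (solve 1 (λ x → con 2ℚ :* x :- x := x) refl (norm² z))
    (solve 2 (λ x y → con 2ℚ :* (con 2ℚ :* (x :+ y)) :- con 4ℚ :* y := con 4ℚ :* x)
      refl (norm² (z ⊕ w)) (norm² w))
    (+-mono-≤ (*-monoˡ-≤ (<⇒≤ (positive⁻¹ 2ℚ)) z≤)
              (neg-antimono-≤ 4w≤z))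
  where
  z≤ : norm² z ≤ 2ℚ * (norm² (z ⊕ w) + norm² w)
  z≤ = subst (_≤ 2ℚ * (norm² (z ⊕ w) + norm² w))
    (solve 4 (λ a b c d →
        ((a :+ c) :+ :- c) :* ((a :+ c) :+ :- c)
          :+ ((b :+ d) :+ :- d) :* ((b :+ d) :+ :- d)
        := a :* a :+ b :* b)
      refl a b c d)
    (norm²-⊝ (z ⊕ w) w)

‖‖-nonneg : ∀ z → 0ℚ ≤ ‖ z ‖
‖‖-nonneg (a , b) = ≤-trans (0≤∣p∣ a) (p≤p⊔q ∣ a ∣ ∣ b ∣)

norm²≤2‖‖² : ∀ z → norm² z ≤ 2ℚ * (‖ z ‖ * ‖ z ‖)
norm²≤2‖‖² z@(a , b) = subst (norm² z ≤_)
  (solve 1 (λ x → x :* x :+ x :* x := con 2ℚ :* (x :* x)) refl ‖ z ‖)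
  (+-mono-≤ (bound a (p≤p⊔q ∣ a ∣ ∣ b ∣)) (bound b (p≤q⊔p ∣ a ∣ ∣ b ∣)))
  where
  bound : ∀ c → ∣ c ∣ ≤ ‖ z ‖ → c * c ≤ ‖ z ‖ * ‖ z ‖
  bound c le = subst (_≤ ‖ z ‖ * ‖ z ‖) (∣p∣*∣p∣≡p*p c) (square-mono (0≤∣p∣ c) le)

‖‖²≤norm² : ∀ z → ‖ z ‖ * ‖ z ‖ ≤ norm² z
‖‖²≤norm² z@(a , b) with ⊔-sel ∣ a ∣ ∣ b ∣
... | inj₁ eq = subst (_≤ norm² z)
  (trans (sym (∣p∣*∣p∣≡p*p a)) (cong (λ t → t * t) (sym eq)))
  (x≤x+y (square-nonneg b))
... | inj₂ eq = subst₂ _≤_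
  (trans (sym (∣p∣*∣p∣≡p*p b)) (cong (λ t → t * t) (sym eq)))
  (+-comm (b * b) (a * a))
  (x≤x+y (square-nonneg a))

‖⊝‖≤ : ∀ z w → ‖ z ⊝ w ‖ ≤ ‖ z ‖ + ‖ w ‖
‖⊝‖≤ (a , b) (c , d) = ⊔-lub
  (≤-trans (∣p-q∣≤∣p∣+∣q∣ a c) (+-mono-≤ (p≤p⊔q ∣ a ∣ ∣ b ∣) (p≤p⊔q ∣ c ∣ ∣ d ∣)))
  (≤-trans (∣p-q∣≤∣p∣+∣q∣ b d) (+-mono-≤ (p≤q⊔p ∣ a ∣ ∣ b ∣) (p≤q⊔p ∣ c ∣ ∣ d ∣)))

‖⊝‖-comm : ∀ z w → ‖ z ⊝ w ‖ ≡ ‖ w ⊝ z ‖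
‖⊝‖-comm (a , b) (c , d) = cong₂ _⊔_ (∣p-q∣≡∣q-p∣ a c) (∣p-q∣≡∣q-p∣ b d)

-- Cells and periodic colourings of the rational line.

p≤∣p∣ : ∀ p → p ≤ ∣ p ∣
p≤∣p∣ p with ≤-total 0ℚ p
... | inj₁ 0≤p = ≤-reflexive (sym (0≤p⇒∣p∣≡p 0≤p))
... | inj₂ p≤0 = ≤-trans p≤0 (0≤∣p∣ p)

x-y<z : ∀ {x y z} → x < y + z → x - y < z
x-y<z {x} {y} {z} lt = subst (x - y <_)
  (solve 2 (λ y z → y :+ z :- y := z) refl y z) (+-monoˡ-< (- y) lt)

fromℤ : ℤ → ℚ
fromℤ i = i / 1

fromℤ-ᵘ : ∀ i → toℚᵘ (fromℤ i) ℚᵘ.≃ ℚᵘ.mkℚᵘ i 0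
fromℤ-ᵘ i = toℚᵘ-fromℚᵘ (ℚᵘ.mkℚᵘ i 0)

fromℤ-+ : ∀ i j → fromℤ (i ℤ.+ j) ≡ fromℤ i + fromℤ j
fromℤ-+ i j = toℚᵘ-injective (ℚᵘₚ.≃-trans (fromℤ-ᵘ (i ℤ.+ j)) (ℚᵘₚ.≃-sym
  (ℚᵘₚ.≃-trans (toℚᵘ-homo-+ (fromℤ i) (fromℤ j))
    (ℚᵘₚ.≃-trans (ℚᵘₚ.+-cong (fromℤ-ᵘ i) (fromℤ-ᵘ j))
      (ℚᵘ.*≡* (cong (ℤ._* ℤ.1ℤ)
        (cong₂ ℤ._+_ (ℤₚ.*-identityʳ i) (ℤₚ.*-identityʳ j))))))))

fromℤ-mono-≤ : ∀ {i j} → i ℤ.≤ j → fromℤ i ≤ fromℤ j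
fromℤ-mono-≤ {i} {j} i≤j = toℚᵘ-cancel-≤
  (ℚᵘₚ.≤-respʳ-≃ (ℚᵘₚ.≃-sym (fromℤ-ᵘ j)) (ℚᵘₚ.≤-respˡ-≃ (ℚᵘₚ.≃-sym (fromℤ-ᵘ i))
    (ℚᵘ.*≤* (ℤₚ.*-monoʳ-≤-nonNeg ℤ.1ℤ i≤j))))

floor-≤ : ∀ p → fromℤ (floor p) ≤ p
floor-≤ p@record{} = toℚᵘ-cancel-≤ (ℚᵘₚ.≤-respˡ-≃ (ℚᵘₚ.≃-sym (fromℤ-ᵘ (floor p)))
  (ℚᵘ.*≤* (subst ((↥ p ℤ./ ↧ p) ℤ.* ↧ p ℤ.≤_) (sym (ℤₚ.*-identityʳ (↥ p)))
    (ℤᵈ.[n/d]*d≤n (↥ p) (↧ p)))))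

<-floor+1 : ∀ p → p < fromℤ (ℤ.suc (floor p))
<-floor+1 p@(mkℚ n d _) = toℚᵘ-cancel-< (ℚᵘₚ.<-respʳ-≃ (ℚᵘₚ.≃-sym (fromℤ-ᵘ (ℤ.suc (floor p))))
  (ℚᵘ.*<* (subst₂ ℤ._<_ (sym (ℤₚ.*-identityʳ n))
    (cong (λ t → ℤ.suc t ℤ.* (+ ℕ.suc d)) (sym (ℤᵈ.div-pos-is-/ℕ n (ℕ.suc d))))
    (ℤᵈ.n<s[n/ℕd]*d n (ℕ.suc d)))))

cells : ∀ {δ} → 0ℚ < δ → ∃ λ (cell : ℚ → ℤ) →
  ∀ x → fromℤ (cell x) * δ ≤ x × x < fromℤ (cell x) * δ + δ
cells {δ} 0<δ = (λ x → floor (x * δ⁻¹)) , λ x →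
  subst (fromℤ (floor (x * δ⁻¹)) * δ ≤_) (rescale x)
    (*-monoʳ-≤ (<⇒≤ 0<δ) (floor-≤ (x * δ⁻¹))) ,
  subst₂ _<_ (rescale x)
    (trans (cong (_* δ) (fromℤ-+ ℤ.1ℤ (floor (x * δ⁻¹))))
      (solve 2 (λ f d → (con 1ℚ :+ f) :* d := f :* d :+ d) refl
        (fromℤ (floor (x * δ⁻¹))) δ))
    (*-monoˡ-<-pos δ (<-floor+1 (x * δ⁻¹)))
  where
  instance
    δ-pos : Positive δ
    δ-pos = positive 0<δ
    δ-nonZero : NonZero δ
    δ-nonZero = pos⇒nonZero δ
  δ⁻¹ : ℚ
  δ⁻¹ = 1/ δ
  rescale : ∀ x → x * δ⁻¹ * δ ≡ x
  rescale x = trans (*-assoc x δ⁻¹ δ)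
    (trans (cong (x *_) (*-inverseˡ δ)) (*-identityʳ x))

-- Equal remainders force the quotients to be strictly ordered, and one step of the quotient is
-- worth `suc k`.
%-gap : ∀ k i j → i ℤᵈ.%ℕ ℕ.suc k ≡ j ℤᵈ.%ℕ ℕ.suc k → i ℤ.< j →
        i ℤ.+ (+ ℕ.suc k) ℤ.≤ j
%-gap k i j i≡j i<j =
  subst₂ ℤ._≤_ left (sym (decompose j)) (ℤₚ.+-monoʳ-≤ (r j)
    (ℤₚ.*-monoʳ-≤-nonNeg K (ℤₚ.i<j⇒suc[i]≤j quotients)))
  where
  K : ℤ
  K = + ℕ.suc k
  r : ℤ → ℤ
  r x = + (x ℤᵈ.%ℕ ℕ.suc k)
  d : ℤ → ℤ
  d x = x ℤᵈ./ℕ ℕ.suc k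
  decompose : ∀ x → x ≡ r x ℤ.+ d x ℤ.* K
  decompose x = ℤᵈ.a≡a%ℕn+[a/ℕn]*n x (ℕ.suc k)
  quotients : d i ℤ.< d j
  quotients = ℤₚ.≰⇒> λ dj≤di → ℤₚ.<⇒≱ i<j (subst₂ ℤ._≤_ (sym (decompose j))
    (sym (trans (decompose i) (cong (λ t → + t ℤ.+ d i ℤ.* K) i≡j)))
    (ℤₚ.+-monoʳ-≤ (r j) (ℤₚ.*-monoʳ-≤-nonNeg K dj≤di)))
  left : r j ℤ.+ ℤ.suc (d i) ℤ.* K ≡ i ℤ.+ K
  left = trans (cong (λ t → r j ℤ.+ t) (trans (ℤₚ.suc-* (d i) K) (ℤₚ.+-comm K (d i ℤ.* K))))
    (trans (sym (ℤₚ.+-assoc (r j) (d i ℤ.* K) K))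
      (cong (ℤ._+ K) (sym (trans (decompose i) (cong (λ t → + t ℤ.+ d i ℤ.* K) i≡j)))))

-- Here `f` and `h` are the cell indices of `x` and `y`. The `1ℚ` pays for the cell of `x`, which
-- ends at `f * δ + δ`; the other `g` cells separate the points.
cell-gap : ∀ {δ x y f g h} → 0ℚ ≤ δ → f + (1ℚ + g) ≤ h →
           h * δ ≤ y → x < f * δ + δ → g * δ ≤ y - x
cell-gap {δ} {x} {y} {f} {g} {h} 0≤δ le le₁ lt₂ = subst (_≤ y - x)
  (solve 3 (λ f g d → (f :+ (con 1ℚ :+ g)) :* d :- (f :* d :+ d) := g :* d) refl f g δ)
  (+-mono-≤ (≤-trans (*-monoʳ-≤ 0≤δ le) le₁) (neg-antimono-≤ (<⇒≤ lt₂)))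

fromℤ-gap : ∀ k i j → i ℤ.+ (+ ℕ.suc k) ℤ.≤ j → fromℤ i + (1ℚ + ℕ→ℚ k) ≤ fromℤ j
fromℤ-gap k i j le = subst (_≤ fromℤ j)
  (trans (fromℤ-+ i (+ ℕ.suc k)) (cong (λ t → fromℤ i + t) (fromℤ-+ ℤ.1ℤ (+ k))))
  (fromℤ-mono-≤ le)

-- Passing to one colour class turns a separation `δ` into `ℕ→ℚ k * δ`, at the cost of a factor
-- `suc k` in size.
GridColouring : ℕ → ℚ → Set
GridColouring k δ = ∃ λ (colour : ℚ → ℕ) →
  (∀ x → colour x ℕ.< ℕ.suc k) ×
  (∀ x y → colour x ≡ colour y → δ ≤ ∣ x - y ∣ → ℕ→ℚ k * δ ≤ ∣ x - y ∣)

-- The colour is the residue modulo k + 1 of the index of the cell of length δ: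
-- distinct cells of one colour are separated by at least k full cells.
grid-colouring⁺ : ∀ k {δ} → 0ℚ < δ → GridColouring k δ
grid-colouring⁺ k {δ} 0<δ =
  (λ x → cell x ℤᵈ.%ℕ ℕ.suc k) , (λ x → ℤᵈ.n%ℕd<d (cell x) (ℕ.suc k)) ,
  (λ x y same δ≤ → spread x y same δ≤ (ℤₚ.<-cmp (cell x) (cell y)))
  where
  cell : ℚ → ℤ
  cell = proj₁ (cells 0<δ)

  in-cell : ∀ x → fromℤ (cell x) * δ ≤ x × x < fromℤ (cell x) * δ + δ
  in-cell = proj₂ (cells 0<δ)

  apart : ∀ x y → cell x ℤᵈ.%ℕ ℕ.suc k ≡ cell y ℤᵈ.%ℕ ℕ.suc k →
          cell x ℤ.< cell y → ℕ→ℚ k * δ ≤ ∣ y - x ∣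
  apart x y same lt = ≤-trans (cell-gap {f = fromℤ (cell x)} {ℕ→ℚ k} {fromℤ (cell y)} (<⇒≤ 0<δ)
    (fromℤ-gap k (cell x) (cell y) (%-gap k (cell x) (cell y) same lt))
    (proj₁ (in-cell y)) (proj₂ (in-cell x))) (p≤∣p∣ (y - x))

  near : ∀ x y → cell x ≡ cell y → x - y < δ
  near x y same = x-y<z (<-≤-trans (proj₂ (in-cell x))
    (+-monoˡ-≤ δ (subst (λ c → fromℤ c * δ ≤ y) (sym same) (proj₁ (in-cell y)))))

  ∣near∣ : ∀ x y → cell x ≡ cell y → ∣ x - y ∣ ≡ x - y ⊎ ∣ x - y ∣ ≡ - (x - y) → ∣ x - y ∣ < δ
  ∣near∣ x y same (inj₁ e) = subst (_< δ) (sym e) (near x y same)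
  ∣near∣ x y same (inj₂ e) = subst (_< δ)
    (trans (solve 2 (λ x y → y :- x := :- (x :- y)) refl x y) (sym e))
    (near y x (sym same))

  spread : ∀ x y → cell x ℤᵈ.%ℕ ℕ.suc k ≡ cell y ℤᵈ.%ℕ ℕ.suc k → δ ≤ ∣ x - y ∣ →
           Tri (cell x ℤ.< cell y) (cell x ≡ cell y) (cell y ℤ.< cell x) →
           ℕ→ℚ k * δ ≤ ∣ x - y ∣
  spread x y same δ≤ (tri< lt _ _) =
    subst (ℕ→ℚ k * δ ≤_) (∣p-q∣≡∣q-p∣ y x) (apart x y same lt)
  spread x y same δ≤ (tri> _ _ gt) = apart y x (sym same) gt
  spread x y same δ≤ (tri≈ _ eq _) = ⊥-elim (<-irrefl refl
    (≤-<-trans δ≤ (∣near∣ x y eq (∣p∣≡p∨∣p∣≡-p (x - y)))))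

-- The scale used later is ‖ u ‖ times the norm of an element, which is 0 when that element is 0.
-- There is then no grid, but `ℕ→ℚ k * δ` is 0 as well and a constant colouring serves.
grid-colouring : ∀ k {δ} → 0ℚ ≤ δ → GridColouring k δ
grid-colouring k {δ} 0≤δ = case δ ≤? 0ℚ of λ where
  (no δ≰0)  → grid-colouring⁺ k (≰⇒> δ≰0)
  (yes δ≤0) → (λ _ → 0) , (λ _ → ℕ.s≤s ℕ.z≤n) , λ x y _ _ →
    subst (_≤ ∣ x - y ∣)
      (sym (trans (cong (ℕ→ℚ k *_) (≤-antisym δ≤0 0≤δ)) (*-zeroʳ (ℕ→ℚ k))))
      (0≤∣p∣ (x - y))

-- Lists: pairwise relations, pigeonhole, products, sorting, minima.

AllPairs-resp-⊆ : ∀ {X : Set} {R : Rel X 0ℓ} {xs ys} → xs ⊆ ys → AllPairs R ys → AllPairs R xs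
AllPairs-resp-⊆ []          []         = []
AllPairs-resp-⊆ (_ ∷ʳ τ)    (_ ∷ rs)   = AllPairs-resp-⊆ τ rs
AllPairs-resp-⊆ (refl ∷ τ)  (r ∷ rs)   = All-resp-⊆ τ r ∷ AllPairs-resp-⊆ τ rs

AllPairs-strengthen : ∀ {X : Set} {P : Pred X 0ℓ} {R S : Rel X 0ℓ} →
  (∀ {x y} → P x → P y → R x y → S x y) →
  ∀ {xs} → All P xs → AllPairs R xs → AllPairs S xs
AllPairs-strengthen f []       []       = []
AllPairs-strengthen f (p ∷ ps) (r ∷ rs) =
  All.zipWith (λ (py , rxy) → f p py rxy) (ps , r) ∷ AllPairs-strengthen f ps rs

AllPairs-++⁻ : ∀ {X : Set} {R : Rel X 0ℓ} xs {ys} → AllPairs R (xs ++ ys) →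
  AllPairs R xs × AllPairs R ys × All (λ x → All (R x) ys) xs
AllPairs-++⁻ []       rs       = [] , rs , []
AllPairs-++⁻ (x ∷ xs) (r ∷ rs) =
  let rxs , rys , cross = AllPairs-++⁻ xs rs
  in Allₚ.++⁻ˡ xs r ∷ rxs , rys , Allₚ.++⁻ʳ xs r ∷ cross

split-length : ∀ {X : Set} q r (xs : List X) → q ℕ.+ r ℕ.≤ length xs →
  ∃ λ ys → ∃ λ zs → xs ≡ ys ++ zs × length ys ≡ q × r ℕ.≤ length zs
split-length zero    r xs       le         = [] , xs , refl , refl , le
split-length (suc q) r (x ∷ xs) (ℕ.s≤s le) =
  let ys , zs , eq , q≡ , r≤ = split-length q r xs le
  in x ∷ ys , zs , cong (x ∷_) eq , cong suc q≡ , r≤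

split-colour : ∀ {X : Set} (f : X → ℕ) K xs → All (λ x → f x ℕ.< suc K) xs →
  ∃ λ ys → ∃ λ zs → ys ⊆ xs × zs ⊆ xs × All (λ x → f x ≡ K) ys × All (λ x → f x ℕ.< K) zs ×
    length xs ≡ length ys ℕ.+ length zs
split-colour f K []       []       = [] , [] , [] , [] , [] , [] , refl
split-colour f K (x ∷ xs) (b ∷ bs) with split-colour f K xs bs | f x ℕₚ.≟ K
... | ys , zs , ys⊆ , zs⊆ , fys , fzs , len | yes eq =
  x ∷ ys , zs , refl ∷ ys⊆ , x ∷ʳ zs⊆ , eq ∷ fys , fzs , cong suc len
... | ys , zs , ys⊆ , zs⊆ , fys , fzs , len | no neq =
  ys , x ∷ zs , x ∷ʳ ys⊆ , refl ∷ zs⊆ , fys , ℕₚ.≤∧≢⇒< (ℕₚ.≤-pred b) neq ∷ fzs ,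
  trans (cong suc len) (sym (ℕₚ.+-suc (length ys) (length zs)))

-- Induction on the number of colours: the class of the top colour is split off, and the longer of
-- it and the class found in the rest is kept.
pigeonhole : ∀ {X : Set} (f : X → ℕ) K xs → All (λ x → f x ℕ.< K) xs →
  ∃ λ c → ∃ λ ys → ys ⊆ xs × All (λ x → f x ≡ c) ys × length xs ℕ.≤ K ℕ.* length ys
pigeonhole f zero    []       []        = 0 , [] , [] , [] , ℕ.z≤n
pigeonhole f (suc K) xs       bs with split-colour f K xs bs
... | ys , zs , ys⊆ , zs⊆ , fys , fzs , len with pigeonhole f K zs fzs
...   | c , ws , ws⊆ , fws , le with ℕₚ.≤-total (length ws) (length ys)
...     | inj₁ ws≤ys = K , ys , ys⊆ , fys , subst (ℕ._≤ suc K ℕ.* length ys) (sym len)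
  (ℕₚ.+-monoʳ-≤ (length ys) (ℕₚ.≤-trans le (ℕₚ.*-monoʳ-≤ K ws≤ys)))
...     | inj₂ ys≤ws = c , ws , ⊆-trans ws⊆ zs⊆ , fws , subst (ℕ._≤ suc K ℕ.* length ws) (sym len)
  (ℕₚ.+-mono-≤ ys≤ws le)

All-cartesianProductWith : ∀ {X Y Z : Set} (f : X → Y → Z)
  {P : Pred X 0ℓ} {Q : Pred Y 0ℓ} {S : Pred Z 0ℓ} →
  (∀ {x y} → P x → Q y → S (f x y)) →
  ∀ {xs ys} → All P xs → All Q ys → All S (cartesianProductWith f xs ys)
All-cartesianProductWith f g []       qs = []
All-cartesianProductWith f g (p ∷ ps) qs =
  Allₚ.++⁺ (Allₚ.map⁺ (All.map (g p) qs)) (All-cartesianProductWith f g ps qs)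

-- Two entries of the product either come from different positions of `xs`, with unrelated second
-- components, or share the first component. For digit strings this is the split by the first
-- differing digit.
AllPairs-cartesianProductWith : ∀ {X Y Z : Set} (f : X → Y → Z)
  {R : Rel X 0ℓ} {P : Pred Y 0ℓ} {S : Rel Y 0ℓ} {Q : Rel Z 0ℓ} →
  (∀ {x x′ y y′} → R x x′ → P y → P y′ → Q (f x y) (f x′ y′)) →
  (∀ {x y y′} → S y y′ → Q (f x y) (f x y′)) →
  ∀ {xs ys} → AllPairs R xs → All P ys → AllPairs S ys →
  AllPairs Q (cartesianProductWith f xs ys)
AllPairs-cartesianProductWith f g h []                 ps ss = []
AllPairs-cartesianProductWith f g h {x ∷ xs} {ys} (r ∷ rs) ps ss = AllPairsₚ.++⁺
  (AllPairsₚ.map⁺ (AllPairs.map h ss))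
  (AllPairs-cartesianProductWith f g h rs ps ss)
  (Allₚ.map⁺ (All.map (λ py → All-cartesianProductWith f (λ rxx′ py′ → g rxx′ py py′) r ps) ps))

length-cartesianProductWith : ∀ {X Y Z : Set} (f : X → Y → Z) xs ys →
  length (cartesianProductWith f xs ys) ≡ length xs ℕ.* length ys
length-cartesianProductWith f []       ys = refl
length-cartesianProductWith f (x ∷ xs) ys = trans
  (length-++ (map (f x) ys))
  (cong₂ ℕ._+_ (length-map (f x) ys) (length-cartesianProductWith f xs ys))

module _ {X : Set} (key : X → ℚ) where

  private
    descending : DecTotalOrder _ _ _
    descending = Flip.decTotalOrder (On.decTotalOrder ≤-decTotalOrder key)

  sort-descending : ∀ {R : Rel X 0ℓ} → Symmetric R → ∀ xs → AllPairs R xs →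
    ∃ λ ys → length ys ≡ length xs × (∀ {P : Pred X 0ℓ} → All P xs → All P ys) ×
      AllPairs R ys × AllPairs (λ x y → key y ≤ key x) ys
  sort-descending R-sym xs rs =
    sort descending xs ,
    Permutationₚ.↭-length (sort-↭ descending xs) ,
    Permutationₚ.All-resp-↭ (↭-sym (sort-↭ descending xs)) ,
    Permutation.AllPairs-resp-↭ (setoid X) R-sym (resp₂ _)
      (↭⇒↭ₛ (↭-sym (sort-↭ descending xs))) rs ,
    Linked⇒AllPairs (λ p q → ≤-trans q p) (sort-↗ descending xs)

argmin : ∀ {X : Set} (f : X → ℚ) x xs →
  ∃ λ a → a ∈ x ∷ xs × All (λ y → f a ≤ f y) (x ∷ xs)
argmin f x []       = x , here refl , ≤-refl ∷ []
argmin f x (y ∷ ys) with argmin f y ys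
... | a , a∈ , le with ≤-total (f x) (f a)
...   | inj₁ x≤a = x , here refl , ≤-refl ∷ All.map (≤-trans x≤a) le
...   | inj₂ a≤x = a , there a∈ , a≤x ∷ le

-- The minimising pair keeps its order in the list. The quantifier over `R` records this: every
-- pairwise relation on the list, symmetric or not, holds for the pair.
argmin-pair : ∀ {X : Set} (f : X → X → ℚ) x y xs →
  ∃ λ a → ∃ λ b → (∀ {R : Rel X 0ℓ} → AllPairs R (x ∷ y ∷ xs) → R a b) ×
    a ∈ x ∷ y ∷ xs × b ∈ x ∷ y ∷ xs × AllPairs (λ u v → f a b ≤ f u v) (x ∷ y ∷ xs)
argmin-pair f x y [] =
  x , y , (λ { ((r ∷ []) ∷ _) → r }) , here refl , there (here refl) ,
  (≤-refl ∷ []) ∷ [] ∷ []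
argmin-pair f x y (z ∷ zs) with argmin (f x) y (z ∷ zs) | argmin-pair f y z zs
... | c , c∈ , c-min | a , b , related , a∈ , b∈ , ab-min with ≤-total (f x c) (f a b)
...   | inj₁ xc≤ab = x , c , (λ { (r ∷ _) → All.lookup r c∈ }) , here refl , there c∈ ,
  c-min ∷ AllPairs.map (≤-trans xc≤ab) ab-min
...   | inj₂ ab≤xc = a , b , (λ { (_ ∷ rs) → related rs }) , there a∈ , there b∈ ,
  All.map (≤-trans ab≤xc) c-min ∷ ab-min

-- Casts from ℕ to ℚ.

fromℤ-* : ∀ i j → fromℤ (i ℤ.* j) ≡ fromℤ i * fromℤ j
fromℤ-* i j = toℚᵘ-injective (ℚᵘₚ.≃-trans (fromℤ-ᵘ (i ℤ.* j)) (ℚᵘₚ.≃-sym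
  (ℚᵘₚ.≃-trans (toℚᵘ-homo-* (fromℤ i) (fromℤ j))
    (ℚᵘₚ.*-cong (fromℤ-ᵘ i) (fromℤ-ᵘ j)))))

ℕ→ℚ-+ : ∀ m n → ℕ→ℚ (m ℕ.+ n) ≡ ℕ→ℚ m + ℕ→ℚ n
ℕ→ℚ-+ m n = fromℤ-+ (+ m) (+ n)

ℕ→ℚ-* : ∀ m n → ℕ→ℚ (m ℕ.* n) ≡ ℕ→ℚ m * ℕ→ℚ n
ℕ→ℚ-* m n = trans (cong fromℤ (ℤₚ.pos-* m n)) (fromℤ-* (+ m) (+ n))

ℕ→ℚ-mono : ∀ {m n} → m ℕ.≤ n → ℕ→ℚ m ≤ ℕ→ℚ n
ℕ→ℚ-mono m≤n = fromℤ-mono-≤ (ℤ.+≤+ m≤n)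

-- Horner form and differences of expansions.

open RawSemiringDefinitions (RawRing.rawSemiring ℚ[i]-rawRing) using () renaming (_^_ to _↑_)

-- P in Horner form: H u v ys = Σ uⁱ vⁿ⁻¹⁻ⁱ yᵢ.
H : ∀ {n} → ℚ[i] → ℚ[i] → Vec ℚ[i] n → ℚ[i]
H             u v []       = 0ℚ , 0ℚ
H {n = suc n} u v (y ∷ ys) = (v ↑ n) ⊗ y ⊕ u ⊗ H u v ys

⊕-⊝-interchange : ∀ x y z w → (x ⊕ y) ⊝ (z ⊕ w) ≡ (x ⊝ z) ⊕ (y ⊝ w)
⊕-⊝-interchange (a , b) (c , d) (e , f) (g , h) = cong₂ _,_ (identity a c e g) (identity b d f h)
  where
  identity : ∀ a c e g → (a + c) + - (e + g) ≡ (a + - e) + (c + - g)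
  identity = solve 4 (λ a c e g →
    (a :+ c) :+ :- (e :+ g) := (a :+ :- e) :+ (c :+ :- g)) refl

⊗-distribˡ-⊝ : ∀ x y z → (x ⊗ y) ⊝ (x ⊗ z) ≡ x ⊗ (y ⊝ z)
⊗-distribˡ-⊝ (a , b) (c , d) (e , f) = cong₂ _,_
  (solve 6 (λ a b c d e f →
      (a :* c :+ :- (b :* d)) :+ :- (a :* e :+ :- (b :* f))
      := a :* (c :+ :- e) :+ :- (b :* (d :+ :- f)))
    refl a b c d e f)
  (solve 6 (λ a b c d e f →
      (a :* d :+ b :* c) :+ :- (a :* f :+ b :* e)
      := a :* (d :+ :- f) :+ b :* (c :+ :- e))
    refl a b c d e f)

⊝-self : ∀ x → x ⊝ x ≡ (0ℚ , 0ℚ)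
⊝-self (a , b) = cong₂ _,_ (+-inverseʳ a) (+-inverseʳ b)

⊕-identityˡ : ∀ x → (0ℚ , 0ℚ) ⊕ x ≡ x
⊕-identityˡ (a , b) = cong₂ _,_ (+-identityˡ a) (+-identityˡ b)

H-⊝ : ∀ {n} u v y y′ (ys ys′ : Vec ℚ[i] n) →
  H u v (y ∷ ys) ⊝ H u v (y′ ∷ ys′) ≡ (v ↑ n) ⊗ (y ⊝ y′) ⊕ u ⊗ (H u v ys ⊝ H u v ys′)
H-⊝ {n} u v y y′ ys ys′ = trans
  (⊕-⊝-interchange ((v ↑ n) ⊗ y) (u ⊗ H u v ys) ((v ↑ n) ⊗ y′) (u ⊗ H u v ys′))
  (cong₂ _⊕_ (⊗-distribˡ-⊝ (v ↑ n) y y′) (⊗-distribˡ-⊝ u (H u v ys) (H u v ys′)))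

H-⊝-tail : ∀ {n} u v y (ys ys′ : Vec ℚ[i] n) →
  H u v (y ∷ ys) ⊝ H u v (y ∷ ys′) ≡ u ⊗ (H u v ys ⊝ H u v ys′)
H-⊝-tail {n} u v y ys ys′ = trans (H-⊝ u v y y ys ys′) (trans
  (cong (_⊕ tail) (trans (cong ((v ↑ n) ⊗_) (⊝-self y)) (⊗-zeroʳ (v ↑ n))))
  (⊕-identityˡ tail))
  where
  tail : ℚ[i]
  tail = u ⊗ (H u v ys ⊝ H u v ys′)

-- Dominance of the leading digit, and thinning.

tail-constant : ℕ → ℕ
tail-constant zero    = 0
-- The recursion is that of `H-bound`: 2 is the constant of `norm²-⊕`, and 16 is this 2 times the 8
-- in `norm² u ≤ 8ℚ * norm² v`.
tail-constant (suc n) = 2 ℕ.+ 16 ℕ.* tail-constant n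

16ℚ 64ℚ : ℚ
16ℚ = + 16 / 1
64ℚ = + 64 / 1

0≤ℕ→ℚ : ∀ n → 0ℚ ≤ ℕ→ℚ n
0≤ℕ→ℚ n = ℕ→ℚ-mono {0} {n} ℕ.z≤n

0≤2ℚ : 0ℚ ≤ 2ℚ
0≤2ℚ = 0≤ℕ→ℚ 2

-- Each term of `H` has degree n - 1 in `u` and `v`, and `u` is at most a constant times `v`. The
-- factor `norm² v` on the left raises the exponent n - 1 to n, which covers n = 0 and avoids
-- division.
H-bound : ∀ {n} u v (ys : Vec ℚ[i] n) {R} → 0ℚ ≤ R → norm² u ≤ 8ℚ * norm² v →
  VecAll.All (λ y → norm² y ≤ R) ys →
  norm² v * norm² (H u v ys) ≤ ℕ→ℚ (tail-constant n) * (norm² (v ↑ n) * R)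
H-bound u v [] {R} 0≤R u≤v VecAll.[] = ≤-reflexive
  (solve 2 (λ a b → a :* con 0ℚ := con 0ℚ :* b) refl (norm² v) (norm² (v ↑ 0) * R))
H-bound {suc n} u v (y ∷ ys) {R} 0≤R u≤v (y≤R VecAll.∷ ys≤R) =
  subst₂ _≤_ refl (sym rhs)
    (≤-trans (*-monoˡ-≤ (norm²-nonneg v) (norm²-⊕ a b))
      (subst (_≤ rhs′)
        (solve 3 (λ x y z → con 2ℚ :* (x :* y :+ x :* z) := x :* (con 2ℚ :* (y :+ z))) refl
          (norm² v) (norm² a) (norm² b))
        (subst (2ℚ * (norm² v * norm² a + norm² v * norm² b) ≤_)
          (solve 4 (λ v p c r →
            con 2ℚ :* (v :* (p :* r) :+ (con 8ℚ :* v) :* (c :* (p :* r)))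
            := (con 2ℚ :+ con 16ℚ :* c) :* ((v :* p) :* r)) refl
            (norm² v) (norm² (v ↑ n)) c R)
          (*-monoˡ-≤ 0≤2ℚ (+-mono-≤ head-≤ tail-≤)))))
  where
  a b : ℚ[i]
  a = (v ↑ n) ⊗ y
  b = u ⊗ H u v ys
  c rhs′ : ℚ
  c = ℕ→ℚ (tail-constant n)
  rhs′ = (2ℚ + 16ℚ * c) * ((norm² v * norm² (v ↑ n)) * R)
  rhs : ℕ→ℚ (tail-constant (suc n)) * (norm² (v ↑ suc n) * R) ≡ rhs′
  rhs = cong₂ _*_
    (trans (ℕ→ℚ-+ 2 (16 ℕ.* tail-constant n)) (cong (λ t → 2ℚ + t) (ℕ→ℚ-* 16 (tail-constant n))))
    (cong (_* R) (norm²-⊗ v (v ↑ n)))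
  head-≤ : norm² v * norm² a ≤ norm² v * (norm² (v ↑ n) * R)
  head-≤ = *-monoˡ-≤ (norm²-nonneg v)
    (subst (_≤ norm² (v ↑ n) * R) (sym (norm²-⊗ (v ↑ n) y)) (*-monoˡ-≤ (norm²-nonneg (v ↑ n)) y≤R))
  tail-≤ : norm² v * norm² b ≤ (8ℚ * norm² v) * (c * (norm² (v ↑ n) * R))
  tail-≤ = subst (_≤ (8ℚ * norm² v) * (c * (norm² (v ↑ n) * R)))
    (trans (solve 3 (λ u v h → u :* (v :* h) := v :* (u :* h)) refl (norm² u) (norm² v) (norm² (H u v ys)))
      (cong (norm² v *_) (sym (norm²-⊗ u (H u v ys)))))
    (*-mono-≤ (*-nonneg (0≤ℕ→ℚ 8) (norm²-nonneg v))
      (*-nonneg (norm²-nonneg v) (norm²-nonneg (H u v ys))) u≤v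
      (H-bound u v ys 0≤R u≤v ys≤R))

-- In `lead-dominates`, 64 is the product of the 4 claimed there, a 2 for `norm² u` against the
-- square of ‖ u ‖, a 4 for the difference of two tails and a 2 for the digits. Only the square of
-- the ratio has to reach this bound; a natural number is at most its square, so no root is taken.
grid-ratio : ℕ → ℕ
grid-ratio n = 64 ℕ.* tail-constant n

n≤n*n : ∀ n → n ℕ.≤ n ℕ.* n
n≤n*n zero    = ℕ.z≤n
n≤n*n (suc n) = ℕₚ.m≤m*n (suc n) (suc n)

-- Both sides are multiplied by `norm² v`. Then `upper` inserts the bounds on `u` and on the tails,
-- `middle` passes to the square of the left side of `far`, and `lower` applies `far` itself.
lead-dominates : ∀ {n} u v Δ (ys ys′ : Vec ℚ[i] n) {r} →
  0ℚ < norm² v → 0ℚ ≤ r → norm² u ≤ 8ℚ * norm² v →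
  VecAll.All (λ y → ‖ y ‖ ≤ r) ys → VecAll.All (λ y → ‖ y ‖ ≤ r) ys′ →
  ℕ→ℚ (grid-ratio n) * (‖ u ‖ * r) ≤ ‖ Δ ‖ * ‖ v ‖ →
  4ℚ * norm² (u ⊗ (H u v ys ⊝ H u v ys′)) ≤ norm² ((v ↑ n) ⊗ Δ)
lead-dominates {n} u v Δ ys ys′ {r} 0<v 0≤r u≤v ys≤r ys′≤r far = *-cancelˡ-≤ 0<v
  (≤-trans upper (≤-trans middle lower))
  where
  R c κ p : ℚ
  R = 2ℚ * (r * r)
  c = ℕ→ℚ (tail-constant n)
  κ = ℕ→ℚ (grid-ratio n)
  p = norm² (v ↑ n)

  κ≡ : κ ≡ 64ℚ * c
  κ≡ = ℕ→ℚ-* 64 (tail-constant n)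

  κ≤κ² : κ ≤ κ * κ
  κ≤κ² = subst (κ ≤_) (ℕ→ℚ-* (grid-ratio n) (grid-ratio n)) (ℕ→ℚ-mono (n≤n*n (grid-ratio n)))

  0≤R : 0ℚ ≤ R
  0≤R = *-nonneg 0≤2ℚ (square-nonneg r)

  norm²≤R : ∀ y → ‖ y ‖ ≤ r → norm² y ≤ R
  norm²≤R y le = ≤-trans (norm²≤2‖‖² y) (*-monoˡ-≤ 0≤2ℚ (square-mono (‖‖-nonneg y) le))

  bound : ∀ {zs} → VecAll.All (λ y → ‖ y ‖ ≤ r) zs → norm² v * norm² (H u v zs) ≤ c * (p * R)
  bound {zs} zs≤r = H-bound u v zs 0≤R u≤v (VecAll.map (λ {y} → norm²≤R y) zs≤r)

  difference : norm² v * norm² (H u v ys ⊝ H u v ys′) ≤ 4ℚ * (c * (p * R))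
  difference = ≤-trans (*-monoˡ-≤ (norm²-nonneg v) (norm²-⊝ (H u v ys) (H u v ys′)))
    (subst₂ _≤_
      (solve 3 (λ v g h → con 2ℚ :* (v :* g :+ v :* h) := v :* (con 2ℚ :* (g :+ h))) refl
        (norm² v) (norm² (H u v ys)) (norm² (H u v ys′)))
      (solve 1 (λ x → con 2ℚ :* (x :+ x) := con 4ℚ :* x) refl (c * (p * R)))
      (*-monoˡ-≤ 0≤2ℚ (+-mono-≤ (bound ys≤r) (bound ys′≤r))))

  upper : norm² v * (4ℚ * norm² (u ⊗ (H u v ys ⊝ H u v ys′))) ≤
          (4ℚ * (2ℚ * (‖ u ‖ * ‖ u ‖))) * (4ℚ * (c * (p * R)))
  upper = subst (_≤ (4ℚ * (2ℚ * (‖ u ‖ * ‖ u ‖))) * (4ℚ * (c * (p * R))))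
    (trans (solve 3 (λ u v d → (con 4ℚ :* u) :* (v :* d) := v :* (con 4ℚ :* (u :* d))) refl
      (norm² u) (norm² v) (norm² (H u v ys ⊝ H u v ys′)))
      (cong (λ t → norm² v * (4ℚ * t)) (sym (norm²-⊗ u (H u v ys ⊝ H u v ys′)))))
    (*-mono-≤ (*-nonneg (0≤ℕ→ℚ 4) (*-nonneg 0≤2ℚ (square-nonneg ‖ u ‖)))
      (*-nonneg (norm²-nonneg v) (norm²-nonneg (H u v ys ⊝ H u v ys′)))
      (*-monoˡ-≤ (0≤ℕ→ℚ 4) (norm²≤2‖‖² u)) difference)

  middle : (4ℚ * (2ℚ * (‖ u ‖ * ‖ u ‖))) * (4ℚ * (c * (p * R))) ≤
           p * ((κ * (‖ u ‖ * r)) * (κ * (‖ u ‖ * r)))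
  middle = subst₂ _≤_
    (trans (cong (_* (p * ((‖ u ‖ * r) * (‖ u ‖ * r)))) κ≡)
      (solve 4 (λ c p u r →
        (con 64ℚ :* c) :* (p :* ((u :* r) :* (u :* r)))
        := (con 4ℚ :* (con 2ℚ :* (u :* u))) :* (con 4ℚ :* (c :* (p :* (con 2ℚ :* (r :* r))))))
        refl c p ‖ u ‖ r))
    (solve 3 (λ k p w → (k :* k) :* (p :* (w :* w)) := p :* ((k :* w) :* (k :* w))) refl
      κ p (‖ u ‖ * r))
    (*-monoʳ-≤ (*-nonneg (norm²-nonneg (v ↑ n)) (square-nonneg (‖ u ‖ * r))) κ≤κ²)

  lower : p * ((κ * (‖ u ‖ * r)) * (κ * (‖ u ‖ * r))) ≤ norm² v * norm² ((v ↑ n) ⊗ Δ)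
  lower = ≤-trans (*-monoˡ-≤ (norm²-nonneg (v ↑ n))
    (square-mono (*-nonneg (0≤ℕ→ℚ (grid-ratio n)) (*-nonneg (‖‖-nonneg u) 0≤r)) far))
    (subst₂ _≤_
      (cong (p *_) (solve 2 (λ d v → (d :* d) :* (v :* v) := (d :* v) :* (d :* v)) refl ‖ Δ ‖ ‖ v ‖))
      (trans (solve 3 (λ p d v → p :* (d :* v) := v :* (p :* d)) refl p (norm² Δ) (norm² v))
        (cong (norm² v *_) (sym (norm²-⊗ (v ↑ n) Δ))))
      (*-monoˡ-≤ (norm²-nonneg (v ↑ n))
        (*-mono-≤ (norm²-nonneg Δ) (square-nonneg ‖ v ‖) (‖‖²≤norm² Δ) (‖‖²≤norm² v))))

-- The sup distance is attained in one of the two coordinates, so it suffices to fix the colour of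
-- each coordinate in turn, losing a factor `suc k` each time. The weight `s` stands in for dividing
-- `δ` by it.
sparsify : ∀ {X : Set} (e : X → ℚ[i]) k {s δ} xs → 0ℚ ≤ s → 0ℚ ≤ δ →
  AllPairs (λ x y → δ ≤ ‖ e x ⊝ e y ‖ * s) xs →
  ∃ λ ys → ys ⊆ xs × AllPairs (λ x y → ℕ→ℚ k * δ ≤ ‖ e x ⊝ e y ‖ * s) ys ×
    length xs ℕ.≤ (suc k ℕ.* suc k) ℕ.* length ys
sparsify {X} e k {s} {δ} xs 0≤s 0≤δ sep =
  let c , ys , ys⊆xs , fys , xs≤ys = pigeonhole f (suc k) xs (All.universal (λ _ → bounded _) xs)
      d , zs , zs⊆ys , gzs , ys≤zs = pigeonhole g (suc k) ys (All.universal (λ _ → bounded _) ys)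
  in zs , ⊆-trans zs⊆ys ys⊆xs ,
    AllPairs-strengthen spread₂ (All.zip (All-resp-⊆ zs⊆ys fys , gzs))
      (AllPairs-resp-⊆ (⊆-trans zs⊆ys ys⊆xs) sep) ,
    ℕₚ.≤-trans xs≤ys (subst (suc k ℕ.* length ys ℕ.≤_)
      (sym (ℕₚ.*-assoc (suc k) (suc k) (length zs)))
      (ℕₚ.*-monoʳ-≤ (suc k) ys≤zs))
  where
  colour : ℚ → ℕ
  colour = proj₁ (grid-colouring k 0≤δ)

  bounded : ∀ x → colour x ℕ.< suc k
  bounded = proj₁ (proj₂ (grid-colouring k 0≤δ))

  f g : X → ℕ
  f x = colour (proj₁ (e x) * s)
  g x = colour (proj₂ (e x) * s)

  scale : ∀ a b → ∣ a * s - b * s ∣ ≡ ∣ a - b ∣ * s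
  scale a b = trans
    (cong ∣_∣ (solve 3 (λ a b s → a :* s :- b :* s := (a :- b) :* s) refl a b s))
    (trans (∣p*q∣≡∣p∣*∣q∣ (a - b) s) (cong (∣ a - b ∣ *_) (0≤p⇒∣p∣≡p 0≤s)))

  spread₁ : ∀ a b → colour (a * s) ≡ colour (b * s) →
            δ ≤ ∣ a - b ∣ * s → ℕ→ℚ k * δ ≤ ∣ a - b ∣ * s
  spread₁ a b same le = subst (ℕ→ℚ k * δ ≤_) (scale a b)
    (proj₂ (proj₂ (grid-colouring k 0≤δ)) (a * s) (b * s) same
      (subst (δ ≤_) (sym (scale a b)) le))

  spread₂ : ∀ {c d x y} → f x ≡ c × g x ≡ d → f y ≡ c × g y ≡ d →
            δ ≤ ‖ e x ⊝ e y ‖ * s → ℕ→ℚ k * δ ≤ ‖ e x ⊝ e y ‖ * s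
  spread₂ {x = x} {y} (fx , gx) (fy , gy) le
    with ⊔-sel ∣ proj₁ (e x) - proj₁ (e y) ∣ ∣ proj₂ (e x) - proj₂ (e y) ∣
  ... | inj₁ eq = subst (λ t → ℕ→ℚ k * δ ≤ t * s) (sym eq)
    (spread₁ (proj₁ (e x)) (proj₁ (e y)) (trans fx (sym fy)) (subst (λ t → δ ≤ t * s) eq le))
  ... | inj₂ eq = subst (λ t → ℕ→ℚ k * δ ≤ t * s) (sym eq)
    (spread₁ (proj₂ (e x)) (proj₂ (e y)) (trans gx (sym gy)) (subst (λ t → δ ≤ t * s) eq le))

-- Separated expansions with digits from consecutive blocks.

infixr 8 _^ℚ_
_^ℚ_ : ℚ → ℕ → ℚ
p ^ℚ zero  = 1ℚ
p ^ℚ suc n = p * p ^ℚ n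

^ℚ-nonneg : ∀ {p} n → 0ℚ ≤ p → 0ℚ ≤ p ^ℚ n
^ℚ-nonneg zero    0≤p = 0≤ℕ→ℚ 1
^ℚ-nonneg (suc n) 0≤p = *-nonneg 0≤p (^ℚ-nonneg n 0≤p)

^ℚ-pos : ∀ {p} n → 0ℚ < p → 0ℚ < p ^ℚ n
^ℚ-pos zero    0<p = positive⁻¹ 1ℚ
^ℚ-pos (suc n) 0<p = *-pos 0<p (^ℚ-pos n 0<p)

^ℚ≤norm²↑ : ∀ {ε} v n → 0ℚ ≤ ε → ε ≤ norm² v → ε ^ℚ n ≤ norm² (v ↑ n)
^ℚ≤norm²↑ v zero    0≤ε ε≤v = ≤-refl
^ℚ≤norm²↑ v (suc n) 0≤ε ε≤v = subst (_ ≤_) (sym (norm²-⊗ v (v ↑ n)))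
  (*-mono-≤ (norm²-nonneg v) (^ℚ-nonneg n 0≤ε) ε≤v (^ℚ≤norm²↑ v n 0≤ε ε≤v))

-- The accumulated cost of thinning: a block with n digits after it is thinned with ratio
-- `grid-ratio n` in both coordinates.
loss : ℕ → ℕ
loss zero    = 1
loss (suc n) = (suc (grid-ratio n) ℕ.* suc (grid-ratio n)) ℕ.* loss n

module _ {X : Set} (e : X → ℚ[i]) where

  -- Every digit position contributes a factor `ε`. The factor 4 is spent once, by `norm²-dominant`
  -- at the first differing digit.
  Separated : ∀ {n} → ℚ → ℚ[i] → ℚ[i] → Rel (Vec X n) 0ℓ
  Separated {n} ε u v s t = ε ^ℚ n ≤ 4ℚ * norm² (H u v (Vec.map e s) ⊝ H u v (Vec.map e t))

  module _ {ε : ℚ} (u v : ℚ[i]) (0<ε : 0ℚ < ε) (ε≤u : ε ≤ norm² u) (ε≤v : ε ≤ norm² v)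
           (u≤v : norm² u ≤ 8ℚ * norm² v) where

    -- The last clause is the minimality of ‖ u ‖ / ‖ v ‖, compared with ‖ e x ⊝ e y ‖ / ‖ e x ‖,
    -- with denominators cleared.
    Related : Rel X 0ℓ
    Related x y = ‖ e y ‖ ≤ ‖ e x ‖ × ε ≤ norm² (e x ⊝ e y) ×
                  ‖ u ‖ * ‖ e x ‖ ≤ ‖ e x ⊝ e y ‖ * ‖ v ‖

    -- The term `lead` dominates `rest`, so the difference keeps at least a quarter of `norm² lead`,
    -- and this is at least `ε` times `ε ^ℚ n`.
    extend-distinct : ∀ {n r} x y (s t : Vec X n) → 0ℚ ≤ r →
      ε ≤ norm² (e x ⊝ e y) × ℕ→ℚ (grid-ratio n) * (‖ u ‖ * r) ≤ ‖ e x ⊝ e y ‖ * ‖ v ‖ →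
      VecAll.All (λ z → ‖ e z ‖ ≤ r) s → VecAll.All (λ z → ‖ e z ‖ ≤ r) t →
      Separated ε u v (x ∷ s) (y ∷ t)
    extend-distinct {n} {r} x y s t 0≤r (apart , far) s≤r t≤r =
      ≤-trans (subst (ε * ε ^ℚ n ≤_)
          (trans (*-comm (norm² (e x ⊝ e y)) (norm² (v ↑ n))) (sym (norm²-⊗ (v ↑ n) (e x ⊝ e y))))
          (*-mono-≤ (norm²-nonneg (e x ⊝ e y)) (^ℚ-nonneg n (<⇒≤ 0<ε)) apart
            (^ℚ≤norm²↑ v n (<⇒≤ 0<ε) ε≤v)))
        (subst (λ d → norm² lead ≤ 4ℚ * norm² d) (sym (H-⊝ u v (e x) (e y) (Vec.map e s) (Vec.map e t)))
          (norm²-dominant lead rest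
            (lead-dominates u v (e x ⊝ e y) (Vec.map e s) (Vec.map e t)
              (<-≤-trans 0<ε ε≤v) 0≤r u≤v (VecAllₚ.map⁺ s≤r) (VecAllₚ.map⁺ t≤r) far)))
      where
      lead rest : ℚ[i]
      lead = (v ↑ n) ⊗ (e x ⊝ e y)
      rest = u ⊗ (H u v (Vec.map e s) ⊝ H u v (Vec.map e t))

    -- The common digit cancels and leaves a factor `u`, whose `norm²` supplies the new `ε`; the 4
    -- is not paid again.
    extend-equal : ∀ {n} x (s t : Vec X n) → Separated ε u v s t → Separated ε u v (x ∷ s) (x ∷ t)
    extend-equal {n} x s t sep = subst (ε * ε ^ℚ n ≤_)
      (trans (solve 2 (λ u d → u :* (con 4ℚ :* d) := con 4ℚ :* (u :* d)) refl (norm² u) (norm² d))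
        (cong (4ℚ *_) (trans (sym (norm²-⊗ u d))
          (cong norm² (sym (H-⊝-tail u v (e x) (Vec.map e s) (Vec.map e t)))))))
      (*-mono-≤ (norm²-nonneg u) (^ℚ-nonneg n (<⇒≤ 0<ε)) ε≤u sep)
      where
      d : ℚ[i]
      d = H u v (Vec.map e s) ⊝ H u v (Vec.map e t)

    -- Cut xs, sorted by decreasing norm, into blocks of q elements.  The head of
    -- what follows a block bounds the later digits and, by the minimality of
    -- ‖ u ‖ / ‖ v ‖, also sets the scale of the separation inside the block.
    digits : ∀ n q xs → AllPairs Related xs → n ℕ.* q ℕ.+ 1 ℕ.≤ length xs →
      ∃ λ (T : List (Vec X n)) → (∀ {P : Pred X 0ℓ} → All P xs → All (VecAll.All P) T) ×
        AllPairs (Separated ε u v) T × q ℕ.^ n ℕ.≤ loss n ℕ.* length T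
    digits zero    q xs rel le = ([] ∷ []) , (λ _ → VecAll.[] ∷ []) , ([] ∷ []) , ℕₚ.≤-refl
    digits (suc n) q xs rel le with split-length q (n ℕ.* q ℕ.+ 1) xs
        (subst (ℕ._≤ length xs) (ℕₚ.+-assoc q (n ℕ.* q) 1) le)
    -- The `+ 1` in the length hypothesis reserves an element after every block, the last included,
    -- so this case cannot occur.
    ... | ys , [] , refl , |ys| , le′ = contradiction (ℕₚ.≤-trans (ℕₚ.m≤n+m 1 (n ℕ.* q)) le′) λ ()
    ... | ys , zs@(z ∷ zs′) , refl , |ys| , le′ with AllPairs-++⁻ ys rel
    ...   | rel-ys , rel-zs@(z-rel ∷ _) , cross =
      cartesianProductWith _∷_ ws T ,
      (λ all → All-cartesianProductWith _∷_ VecAll._∷_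
        (All-resp-⊆ ws⊆ys (Allₚ.++⁻ˡ ys all)) (T-within (Allₚ.++⁻ʳ ys all))) ,
      AllPairs-cartesianProductWith _∷_
        (λ {x} {y} {s} {t} → extend-distinct x y s t (‖‖-nonneg (e z)))
        (λ {x} {s} {t} → extend-equal x s t)
        (AllPairs.zipWith (λ ((_ , apart , _) , far) → apart , far)
          (AllPairs-resp-⊆ ws⊆ys rel-ys , far-ws))
        -- As the list is sorted, `z` bounds the norm of everything in `zs`, hence of every later
        -- digit.
        (T-within (≤-refl ∷ All.map proj₁ z-rel))
        T-sep ,
      subst₂ ℕ._≤_ (cong (ℕ._* q ℕ.^ n) |ys|)
        (trans (ℕₚ.[m*n]*[o*p]≡[m*o]*[n*p] (K ℕ.* K) (length ws) (loss n) (length T))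
          (cong (loss (suc n) ℕ.*_) (sym (length-cartesianProductWith _∷_ ws T))))
        (ℕₚ.*-mono-≤ ys≤ws q^n≤)
      where
      K : ℕ
      K = suc (grid-ratio n)

      block-sep : AllPairs (λ x y → ‖ u ‖ * ‖ e z ‖ ≤ ‖ e x ⊝ e y ‖ * ‖ v ‖) ys
      block-sep = AllPairs-strengthen
        -- Elements of the block are at least as large as `z`, so a separation relative to ‖ e x ‖
        -- gives one at the common scale ‖ e z ‖.
        (λ { (z≤x ∷ _) _ (_ , _ , ratio) →
          ≤-trans (*-monoˡ-≤ (‖‖-nonneg u) (proj₁ z≤x)) ratio })
        cross rel-ys

      sparse = sparsify e (grid-ratio n) ys (‖‖-nonneg v)
        (*-nonneg (‖‖-nonneg u) (‖‖-nonneg (e z))) block-sep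
      ws     = proj₁ sparse
      ws⊆ys  = proj₁ (proj₂ sparse)
      far-ws = proj₁ (proj₂ (proj₂ sparse))
      ys≤ws  = proj₂ (proj₂ (proj₂ sparse))

      rest = digits n q zs rel-zs le′
      T        = proj₁ rest
      T-within : ∀ {P : Pred X 0ℓ} → All P zs → All (VecAll.All P) T
      T-within = proj₁ (proj₂ rest)
      T-sep    = proj₁ (proj₂ (proj₂ rest))
      q^n≤     = proj₂ (proj₂ (proj₂ rest))

-- Choice of the base pair.

-- Division with p ÷₀ 0 = 0.
_÷₀_ : ℚ → ℚ → ℚ
p ÷₀ q = by (q ≟ 0ℚ)
  where
  by : Dec (q ≡ 0ℚ) → ℚ
  by (yes _)  = 0ℚ
  by (no q≢0) = p * (1/ q) {{≢-nonZero q≢0}}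

÷₀-* : ∀ p {q} → 0ℚ < q → (p ÷₀ q) * q ≡ p
÷₀-* p {q} 0<q with q ≟ 0ℚ
... | yes q≡0 = contradiction (sym q≡0) (<⇒≢ 0<q)
... | no q≢0  = trans (*-assoc p _ q)
  (trans (cong (p *_) (*-inverseˡ q {{≢-nonZero q≢0}})) (*-identityʳ p))

module _ {X : Set} (e : X → ℚ[i]) where

  value : ∀ {n} → Vec X (2 ℕ.+ n) → ℚ[i]
  value (a ∷ b ∷ s) = H (e b ⊝ e a) (e a) (Vec.map e s)

  module _ {g : ℚ} (0<g : 0ℚ < g) where

    Ordered : Rel X 0ℓ
    Ordered x y = g + g ≤ ‖ e x ⊝ e y ‖ × ‖ e y ‖ ≤ ‖ e x ‖

    -- Points at distance at least `g + g` cannot both have norm below `g`, and `x` is the larger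
    -- one. This keeps v away from 0.
    ordered⇒large : ∀ {x y} → Ordered x y → g ≤ ‖ e x ‖
    ordered⇒large {x} {y} (apart , y≤x) = *-cancelˡ-≤ (positive⁻¹ 2ℚ)
      (subst₂ _≤_ (double g) (double ‖ e x ‖)
      (≤-trans apart (≤-trans (‖⊝‖≤ (e x) (e y)) (+-monoʳ-≤ ‖ e x ‖ y≤x))))
      where
      double : ∀ p → p + p ≡ 2ℚ * p
      double = solve 1 (λ p → p :+ p := con 2ℚ :* p) refl

    square≤norm² : ∀ z → g ≤ ‖ z ‖ → g * g ≤ norm² z
    square≤norm² z le = ≤-trans (square-mono (<⇒≤ 0<g) le) (‖‖²≤norm² z)

    g≤g+g : g ≤ g + g
    g≤g+g = x≤x+y (<⇒≤ 0<g)

    -- The sup norm of the difference is at most twice that of `e x`. Squaring gives 4 and the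
    -- comparison of norms another 2.
    ordered⇒norm²≤ : ∀ {x y} → Ordered x y → norm² (e y ⊝ e x) ≤ 8ℚ * norm² (e x)
    ordered⇒norm²≤ {x} {y} (_ , y≤x) = ≤-trans (norm²≤2‖‖² (e y ⊝ e x))
      (≤-trans (*-monoˡ-≤ 0≤2ℚ (square-mono (‖‖-nonneg (e y ⊝ e x))
          (≤-trans (‖⊝‖≤ (e y) (e x)) (+-monoˡ-≤ ‖ e x ‖ y≤x))))
        (subst (_≤ 8ℚ * norm² (e x))
          (solve 1 (λ x → con 8ℚ :* (x :* x) := con 2ℚ :* ((x :+ x) :* (x :+ x))) refl ‖ e x ‖)
          (*-monoˡ-≤ (0≤ℕ→ℚ 8) (‖‖²≤norm² (e x)))))

    ratio : X → X → ℚ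
    ratio x y = ‖ e x ⊝ e y ‖ ÷₀ ‖ e x ‖

    ratio-* : ∀ {x y} → Ordered x y → ratio x y * ‖ e x ‖ ≡ ‖ e x ⊝ e y ‖
    ratio-* {x} {y} ord = ÷₀-* ‖ e x ⊝ e y ‖ (<-≤-trans 0<g (ordered⇒large ord))

    cross-ratio : ∀ {a b x y} → Ordered a b → Ordered x y → ratio a b ≤ ratio x y →
                  ‖ e b ⊝ e a ‖ * ‖ e x ‖ ≤ ‖ e x ⊝ e y ‖ * ‖ e a ‖
    cross-ratio {a} {b} {x} {y} ab xy le = subst₂ _≤_
      (trans (solve 3 (λ r a x → r :* (a :* x) := (r :* a) :* x) refl (ratio a b) ‖ e a ‖ ‖ e x ‖)
        (cong (_* ‖ e x ‖) (trans (ratio-* ab) (‖⊝‖-comm (e a) (e b)))))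
      (trans (solve 3 (λ r a x → r :* (a :* x) := (r :* x) :* a) refl (ratio x y) ‖ e a ‖ ‖ e x ‖)
        (cong (_* ‖ e a ‖) (ratio-* xy)))
      (*-monoʳ-≤ (*-nonneg (‖‖-nonneg (e a)) (‖‖-nonneg (e x))) le)

    -- Quantifying over `P` says that the tuples draw on `xs` only, in a form that passes directly
    -- through sorting.
    SeparatedValues : ∀ n → ℕ → List X → Set₁
    SeparatedValues n q xs = ∃ λ (T : List (Vec X (2 ℕ.+ n))) →
      (∀ {P : Pred X 0ℓ} → All P xs → All (VecAll.All P) T) ×
      AllPairs (λ s t → (g * g) ^ℚ n ≤ 4ℚ * norm² (value s ⊝ value t)) T ×
      q ℕ.^ n ℕ.≤ loss n ℕ.* length T

    sorted-separated-values : ∀ n q x y ys → AllPairs Ordered (x ∷ y ∷ ys) →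
      n ℕ.* q ℕ.+ 1 ℕ.≤ length (x ∷ y ∷ ys) → SeparatedValues n q (x ∷ y ∷ ys)
    sorted-separated-values n q x y ys ord le =
      map extend T ,
      (λ all → Allₚ.map⁺ (All.map
        (λ ps → All.lookup all a∈ VecAll.∷ All.lookup all b∈ VecAll.∷ ps) (T-within all))) ,
      AllPairsₚ.map⁺ T-sep ,
      subst (λ l → q ℕ.^ n ℕ.≤ loss n ℕ.* l) (sym (length-map extend T)) q^n≤
      where
      minimum = argmin-pair ratio x y ys
      a b : X
      a = proj₁ minimum
      b = proj₁ (proj₂ minimum)
      related : ∀ {R : Rel X 0ℓ} → AllPairs R (x ∷ y ∷ ys) → R a b
      related = proj₁ (proj₂ (proj₂ minimum))
      a∈      = proj₁ (proj₂ (proj₂ (proj₂ minimum)))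
      b∈      = proj₁ (proj₂ (proj₂ (proj₂ (proj₂ minimum))))
      minimal = proj₂ (proj₂ (proj₂ (proj₂ (proj₂ minimum))))

      extend : Vec X n → Vec X (2 ℕ.+ n)
      extend s = a ∷ b ∷ s

      ab : Ordered a b
      ab = related ord

      0<ε : 0ℚ < g * g
      0<ε = *-pos 0<g 0<g

      ε≤u : g * g ≤ norm² (e b ⊝ e a)
      ε≤u = square≤norm² (e b ⊝ e a)
        (≤-trans g≤g+g (subst (g + g ≤_) (‖⊝‖-comm (e a) (e b)) (proj₁ ab)))

      ε≤v : g * g ≤ norm² (e a)
      ε≤v = square≤norm² (e a) (ordered⇒large ab)

      all-related : AllPairs (Related e (e b ⊝ e a) (e a) 0<ε ε≤u ε≤v (ordered⇒norm²≤ ab)) (x ∷ y ∷ ys)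
      all-related = AllPairs.zipWith
        (λ {x} {y} (xy , min) →
          proj₂ xy , square≤norm² (e x ⊝ e y) (≤-trans g≤g+g (proj₁ xy)) , cross-ratio ab xy min)
        (ord , minimal)

      result = digits e (e b ⊝ e a) (e a) 0<ε ε≤u ε≤v (ordered⇒norm²≤ ab) n q (x ∷ y ∷ ys) all-related le
      T        = proj₁ result
      T-within : ∀ {P : Pred X 0ℓ} → All P (x ∷ y ∷ ys) → All (VecAll.All P) T
      T-within = proj₁ (proj₂ result)
      T-sep    = proj₁ (proj₂ (proj₂ result))
      q^n≤     = proj₂ (proj₂ (proj₂ result))

    separated-values : ∀ n q xs → AllPairs (λ x y → g + g ≤ ‖ e x ⊝ e y ‖) xs →
      2 ℕ.≤ length xs → n ℕ.* q ℕ.+ 1 ℕ.≤ length xs → SeparatedValues n q xs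
    separated-values n q xs sep 2≤ le =
      let zs , len , within , sep′ , sorted = sort-descending (λ x → ‖ e x ‖)
            (λ {x} {y} → subst (g + g ≤_) (‖⊝‖-comm (e x) (e y))) xs sep
          T , T-within , rest = go zs (subst (2 ℕ.≤_) (sym len) 2≤)
            (subst (n ℕ.* q ℕ.+ 1 ℕ.≤_) (sym len) le) (AllPairs.zip (sep′ , sorted))
      in T , (λ all → T-within (within all)) , rest
      where
      go : ∀ zs → 2 ℕ.≤ length zs → n ℕ.* q ℕ.+ 1 ℕ.≤ length zs → AllPairs Ordered zs →
           SeparatedValues n q zs
      go (x ∷ y ∷ ys) _           le ord = sorted-separated-values n q x y ys ord le
      go (x ∷ [])     (ℕ.s≤s ()) le ord

-- Evaluation at an index.

module ℂ-raw = RawRing ℂ-rawRing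

open RawSemiringDefinitions (RawRing.rawSemiring ℂ-rawRing) using ()
  renaming (_^_ to _↑ᶜ_; sum to sumᶜ)
open RawSemiringDefinitions (RawRing.rawSemiring ℚ[i]-rawRing) using () renaming (sum to sumᵍ)

at : ℕ → ℂ → ℚ[i]
at k z = seq (re z) k , seq (im z) k

at-↑ : ∀ k z n → at k (z ↑ᶜ n) ≡ at k z ↑ n
at-↑ k z zero    = refl
at-↑ k z (suc n) = cong (at k z ⊗_) (at-↑ k z n)

at-sum : ∀ k {n} (f : Vector ℂ n) {g : Vector ℚ[i] n} → (∀ i → at k (f i) ≡ g i) →
         at k (sumᶜ f) ≡ sumᵍ g
at-sum k {zero}  f eq = refl
at-sum k {suc n} f eq = cong₂ _⊕_ (eq fzero) (at-sum k (f ∘ fsuc) (eq ∘ fsuc))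

sum-cong : ∀ {n} {f g : Vector ℚ[i] n} → (∀ i → f i ≡ g i) → sumᵍ f ≡ sumᵍ g
sum-cong {zero}  eq = refl
sum-cong {suc n} eq = cong₂ _⊕_ (eq fzero) (sum-cong (eq ∘ fsuc))

sum-distribˡ : ∀ {n} u (f : Vector ℚ[i] n) → sumᵍ (λ i → u ⊗ f i) ≡ u ⊗ sumᵍ f
sum-distribˡ {zero}  u f = sym (⊗-zeroʳ u)
sum-distribˡ {suc n} u f = trans (cong (u ⊗ f fzero ⊕_) (sum-distribˡ u (f ∘ fsuc)))
  (sym (⊗-distribˡ-⊕ u (f fzero) (sumᵍ (f ∘ fsuc))))

sum≡H : ∀ {n} u v (ys : Vec ℚ[i] n) →
  sumᵍ (λ i → ((u ↑ toℕ i) ⊗ (v ↑ (n ∸ suc (toℕ i)))) ⊗ Vec.lookup ys i) ≡ H u v ys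
sum≡H             u v []       = refl
sum≡H {n = suc n} u v (y ∷ ys) = cong₂ _⊕_
  (cong (_⊗ y) (⊗-identityˡ (v ↑ n)))
  (trans (sum-cong factor) (trans (sum-distribˡ u term) (cong (u ⊗_) (sum≡H u v ys))))
  where
  coefficient term : Vector ℚ[i] n
  coefficient i = (u ↑ toℕ i) ⊗ (v ↑ (n ∸ suc (toℕ i)))
  term i = coefficient i ⊗ Vec.lookup ys i
  factor : ∀ i → ((u ⊗ (u ↑ toℕ i)) ⊗ (v ↑ (n ∸ suc (toℕ i)))) ⊗ Vec.lookup ys i ≡ u ⊗ term i
  factor i = trans
    (cong (_⊗ Vec.lookup ys i) (⊗-assoc u (u ↑ toℕ i) (v ↑ (n ∸ suc (toℕ i)))))
    (⊗-assoc u (coefficient i) (Vec.lookup ys i))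

HasHornerForm : ∀ n → (Vector ℂ (2 ℕ.+ n) → ℂ) → Set
HasHornerForm n F = ∀ k s → at k (F (Vec.lookup s)) ≡ value (at k) s

P-horner : ∀ n → HasHornerForm n (P ℂ-rawRing n)
P-horner n k (a ∷ b ∷ s) = trans
  (at-sum k _ λ i → cong₂ _⊗_
    (cong₂ _⊗_ (at-↑ k _ (toℕ i)) (at-↑ k a (n ∸ suc (toℕ i))))
    (sym (lookup-map i (at k) s)))
  (sum≡H (at k b ⊝ at k a) (at k a) (Vec.map (at k) s))

-- Congruence of the operations and of `P`.

+ᴿ-cong : ∀ x x′ y y′ → x ≈ᴿ x′ → y ≈ᴿ y′ → x +ᴿ y ≈ᴿ x′ +ᴿ y′
+ᴿ-cong x x′ y y′ x≈ y≈ .close ε 0<ε =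
  let N₁ , p = close x≈ (½ * ε) (half-pos 0<ε)
      N₂ , q = close y≈ (½ * ε) (half-pos 0<ε)
  in N₁ ℕ.⊔ N₂ , λ n N≤n → abs-split _ _ ε
       (solve 4 (λ a b c d → (a :+ b) :- (c :+ d) := (a :- c) :+ (b :- d)) refl
         (seq x n) (seq y n) (seq x′ n) (seq y′ n))
       refl
       (p n (ℕₚ.m⊔n≤o⇒m≤o N₁ N₂ N≤n)) (q n (ℕₚ.m⊔n≤o⇒n≤o N₁ N₂ N≤n))

-ᴿ-cong : ∀ x x′ → x ≈ᴿ x′ → -ᴿ x ≈ᴿ -ᴿ x′
-ᴿ-cong x x′ x≈ .close ε 0<ε =
  let N , p = close x≈ ε 0<ε
  in N , λ n N≤n → subst (_< ε)
       (trans (∣p-q∣≡∣q-p∣ (seq x n) (seq x′ n))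
         (cong ∣_∣ (solve 2 (λ a b → b :- a := (:- a) :- (:- b)) refl (seq x n) (seq x′ n))))
       (p n N≤n)

*ᴿ-congˡ : ∀ x y y′ → y ≈ᴿ y′ → x *ᴿ y ≈ᴿ x *ᴿ y′
*ᴿ-congˡ x y y′ y≈ .close ε 0<ε =
  let B , M , 0<B , x<B = eventually-bounded x
      δ , 0<δ , Bδ = scaled-pos 0<B (half-pos 0<ε)
      N , p = close y≈ δ 0<δ
  in M ℕ.⊔ N , λ n h → abs-split (seq x n * (seq y n - seq y′ n)) 0ℚ ε
       (solve 3 (λ a b c → a :* b :- a :* c := a :* (b :- c) :+ con 0ℚ) refl
         (seq x n) (seq y n) (seq y′ n))
       refl
       (<-trans (subst (∣ seq x n * (seq y n - seq y′ n) ∣ <_) Bδ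
         (abs-*-< (seq x n) 0<B (x<B n (ℕₚ.m⊔n≤o⇒m≤o M N h)) (p n (ℕₚ.m⊔n≤o⇒n≤o M N h))))
         (half< (half-pos 0<ε)))
       (half-pos 0<ε)
  where
  half< : ∀ {ε} → 0ℚ < ε → ½ * ε < ε
  half< {ε} 0<ε = subst₂ _<_ (+-identityʳ (½ * ε)) (½ε+½ε≡ε ε)
    (+-monoʳ-< (½ * ε) (half-pos 0<ε))

*ᴿ-comm : ∀ x y → x *ᴿ y ≈ᴿ y *ᴿ x
*ᴿ-comm x y .close ε 0<ε = 0 , λ n _ →
  subst (λ t → ∣ seq x n * seq y n - t ∣ < ε) (*-comm (seq x n) (seq y n))
    (∣p-p∣<ε (seq x n * seq y n) 0<ε)

*ᴿ-cong : ∀ x x′ y y′ → x ≈ᴿ x′ → y ≈ᴿ y′ → x *ᴿ y ≈ᴿ x′ *ᴿ y′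
*ᴿ-cong x x′ y y′ x≈ y≈ = ≈ᴿ-trans {x *ᴿ y} {x *ᴿ y′} {x′ *ᴿ y′} (*ᴿ-congˡ x y y′ y≈)
  (≈ᴿ-trans {x *ᴿ y′} {y′ *ᴿ x} {x′ *ᴿ y′} (*ᴿ-comm x y′)
    (≈ᴿ-trans {y′ *ᴿ x} {y′ *ᴿ x′} {x′ *ᴿ y′} (*ᴿ-congˡ y′ x x′ x≈) (*ᴿ-comm y′ x′)))

+ᶜ-cong : ∀ x x′ y y′ → x ≈ᶜ x′ → y ≈ᶜ y′ → x ℂ-raw.+ y ≈ᶜ x′ ℂ-raw.+ y′
+ᶜ-cong x x′ y y′ p q = mk≈ᶜ
  (+ᴿ-cong (re x) (re x′) (re y) (re y′) (re-≈ p) (re-≈ q))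
  (+ᴿ-cong (im x) (im x′) (im y) (im y′) (im-≈ p) (im-≈ q))

*ᶜ-cong : ∀ x x′ y y′ → x ≈ᶜ x′ → y ≈ᶜ y′ → x ℂ-raw.* y ≈ᶜ x′ ℂ-raw.* y′
*ᶜ-cong x x′ y y′ p q = mk≈ᶜ
  (+ᴿ-cong (re x *ᴿ re y) (re x′ *ᴿ re y′) (-ᴿ (im x *ᴿ im y)) (-ᴿ (im x′ *ᴿ im y′))
    (*ᴿ-cong (re x) (re x′) (re y) (re y′) (re-≈ p) (re-≈ q))
    (-ᴿ-cong (im x *ᴿ im y) (im x′ *ᴿ im y′)
      (*ᴿ-cong (im x) (im x′) (im y) (im y′) (im-≈ p) (im-≈ q))))
  (+ᴿ-cong (re x *ᴿ im y) (re x′ *ᴿ im y′) (im x *ᴿ re y) (im x′ *ᴿ re y′)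
    (*ᴿ-cong (re x) (re x′) (im y) (im y′) (re-≈ p) (im-≈ q))
    (*ᴿ-cong (im x) (im x′) (re y) (re y′) (im-≈ p) (re-≈ q)))

-ᶜ-cong : ∀ x x′ → x ≈ᶜ x′ → ℂ-raw.- x ≈ᶜ ℂ-raw.- x′
-ᶜ-cong x x′ p = mk≈ᶜ (-ᴿ-cong (re x) (re x′) (re-≈ p)) (-ᴿ-cong (im x) (im x′) (im-≈ p))

module _ (R : RawRing 0ℓ 0ℓ) where
  private module R = RawRing R
  open R using (_≈_)
  open RawSemiringDefinitions R.rawSemiring using () renaming (_^_ to _↑ᴿ_; sum to sumᴿ)

  module _ (≈-refl : ∀ x → x ≈ x)
           (+-cong : ∀ x x′ y y′ → x ≈ x′ → y ≈ y′ → x R.+ y ≈ x′ R.+ y′)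
           (*-cong : ∀ x x′ y y′ → x ≈ x′ → y ≈ y′ → x R.* y ≈ x′ R.* y′)
           (-‿cong : ∀ x x′ → x ≈ x′ → R.- x ≈ R.- x′) where

    ↑-cong : ∀ x x′ n → x ≈ x′ → x ↑ᴿ n ≈ x′ ↑ᴿ n
    ↑-cong x x′ zero    p = ≈-refl R.1#
    ↑-cong x x′ (suc n) p = *-cong x x′ (x ↑ᴿ n) (x′ ↑ᴿ n) p (↑-cong x x′ n p)

    sum-≈-cong : ∀ {n} (f g : Vector R.Carrier n) → (∀ i → f i ≈ g i) → sumᴿ f ≈ sumᴿ g
    sum-≈-cong {zero}  f g eq = ≈-refl R.0#
    sum-≈-cong {suc n} f g eq = +-cong (f fzero) (g fzero) (sumᴿ (f ∘ fsuc)) (sumᴿ (g ∘ fsuc))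
      (eq fzero) (sum-≈-cong (f ∘ fsuc) (g ∘ fsuc) (eq ∘ fsuc))

    P-≈-cong : ∀ n (x y : Vector R.Carrier (2 ℕ.+ n)) → (∀ j → x j ≈ y j) → P R n x ≈ P R n y
    P-≈-cong n x y eq = sum-≈-cong {n} _ _ λ i →
      *-cong _ _ _ _
        (*-cong _ _ _ _
          (↑-cong _ _ (toℕ i)
            (+-cong _ _ _ _ (eq (fsuc fzero)) (-‿cong _ _ (eq fzero))))
          (↑-cong _ _ (n ∸ suc (toℕ i)) (eq fzero)))
        (eq (fsuc (fsuc i)))

P-cong : ∀ n (x y : Vector ℂ (2 ℕ.+ n)) → (∀ j → x j ≈ᶜ y j) →
         P ℂ-rawRing n x ≈ᶜ P ℂ-rawRing n y
P-cong = P-≈-cong ℂ-rawRing (λ x → mk≈ᶜ (≈ᴿ-refl {re x}) (≈ᴿ-refl {im x})) +ᶜ-cong *ᶜ-cong -ᶜ-cong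

-- Apartness and approximation at a late index.

SettledBy : ℚ → ℕ → ℝ → Set
SettledBy δ N x = ∀ m n → N ℕ.≤ m → N ℕ.≤ n → ∣ seq x m - seq x n ∣ < δ

∣a-b∣≤ : ∀ a b c d → ∣ a - b ∣ ≤ ∣ c - d ∣ + (∣ a - c ∣ + ∣ d - b ∣)
∣a-b∣≤ a b c d = subst (λ t → ∣ t ∣ ≤ ∣ c - d ∣ + (∣ a - c ∣ + ∣ d - b ∣))
  (solve 4 (λ a b c d → (c :- d) :+ ((a :- c) :+ (d :- b)) := a :- b) refl a b c d)
  (≤-trans (∣p+q∣≤∣p∣+∣q∣ (c - d) ((a - c) + (d - b)))
    (+-monoʳ-≤ ∣ c - d ∣ (∣p+q∣≤∣p∣+∣q∣ (a - c) (d - b))))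

settled-distance : ∀ {δ N} x y → SettledBy δ N x → SettledBy δ N y →
  ∀ m n → N ℕ.≤ m → N ℕ.≤ n →
  ∣ seq x m - seq y m ∣ < ∣ seq x n - seq y n ∣ + (δ + δ)
settled-distance x y sx sy m n N≤m N≤n =
  ≤-<-trans (∣a-b∣≤ (seq x m) (seq y m) (seq x n) (seq y n))
    (+-monoʳ-< ∣ seq x n - seq y n ∣ (+-mono-< (sx m n N≤m N≤n) (sy n m N≤n N≤m)))

EventuallyApart : ℝ → ℝ → Set
EventuallyApart x y = ∃ λ ε → ∃ λ N → 0ℚ < ε × (∀ n → N ℕ.≤ n → ε ≤ ∣ seq x n - seq y n ∣)

-- With `δ` a quarter of ε, both sequences move by less than `δ` after `N`, where distances of
-- rationals can be compared. A distance of at most `δ + δ` stays below ε from then on; a larger one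
-- stays at least `d - (δ + δ)`, which is apartness.
¬apart⇒≈ᴿ : ∀ x y → ¬ EventuallyApart x y → x ≈ᴿ y
¬apart⇒≈ᴿ x y ¬apart .close ε 0<ε = by (d ≤? δ + δ)
  where
  δ : ℚ
  δ = ½ * (½ * ε)
  0<δ : 0ℚ < δ
  0<δ = half-pos (half-pos 0<ε)
  N₁ N₂ N : ℕ
  N₁ = proj₁ (cauchy x δ 0<δ)
  N₂ = proj₁ (cauchy y δ 0<δ)
  N  = N₁ ℕ.⊔ N₂
  settled-x : SettledBy δ N x
  settled-x m n N≤m N≤n = proj₂ (cauchy x δ 0<δ) m n
    (ℕₚ.m⊔n≤o⇒m≤o N₁ N₂ N≤m) (ℕₚ.m⊔n≤o⇒m≤o N₁ N₂ N≤n)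
  settled-y : SettledBy δ N y
  settled-y m n N≤m N≤n = proj₂ (cauchy y δ 0<δ) m n
    (ℕₚ.m⊔n≤o⇒n≤o N₁ N₂ N≤m) (ℕₚ.m⊔n≤o⇒n≤o N₁ N₂ N≤n)
  d : ℚ
  d = ∣ seq x N - seq y N ∣
  by : Dec (d ≤ δ + δ) → ∃ λ N → ∀ n → N ℕ.≤ n → ∣ seq x n - seq y n ∣ < ε
  by (yes small) = N , λ n N≤n → subst (∣ seq x n - seq y n ∣ <_)
    (trans (cong₂ _+_ (½ε+½ε≡ε (½ * ε)) (½ε+½ε≡ε (½ * ε))) (½ε+½ε≡ε ε))
    (<-≤-trans (settled-distance x y settled-x settled-y n N N≤n ℕₚ.≤-refl)
      (+-monoˡ-≤ (δ + δ) small))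
  by (no large) = ⊥-elim (¬apart (d - (δ + δ) , N ,
    subst (_< d - (δ + δ)) (+-inverseʳ (δ + δ)) (+-monoˡ-< (- (δ + δ)) (≰⇒> large)) ,
    λ n N≤n → <⇒≤ (x-y<z (subst (d <_) (+-comm ∣ seq x n - seq y n ∣ (δ + δ))
      (settled-distance x y settled-x settled-y N n ℕₚ.≤-refl N≤n)))))

EventuallyApartᶜ : ℂ → ℂ → Set
EventuallyApartᶜ z w = ∃ λ ε → ∃ λ N → 0ℚ < ε × (∀ n → N ℕ.≤ n → ε ≤ ‖ at n z ⊝ at n w ‖)

-- Constructively, inequality yields apartness only under a double negation. This suffices, as the
-- final bound is itself doubly negated.
≉⇒¬¬apart : ∀ {z w} → ¬ (z ≈ᶜ w) → ¬ ¬ EventuallyApartᶜ z w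
≉⇒¬¬apart {z} {w} z≉w ¬apart = z≉w (mk≈ᶜ
  (¬apart⇒≈ᴿ (re z) (re w) λ (ε , N , 0<ε , far) → ¬apart (ε , N , 0<ε , λ n N≤n →
    ≤-trans (far n N≤n) (p≤p⊔q ∣ seq (re z) n - seq (re w) n ∣ ∣ seq (im z) n - seq (im w) n ∣)))
  (¬apart⇒≈ᴿ (im z) (im w) λ (ε , N , 0<ε , far) → ¬apart (ε , N , 0<ε , λ n N≤n →
    ≤-trans (far n N≤n) (p≤q⊔p ∣ seq (re z) n - seq (re w) n ∣ ∣ seq (im z) n - seq (im w) n ∣))))

¬¬-All : ∀ {X : Set} {P : Pred X 0ℓ} {xs} → All (λ x → ¬ ¬ P x) xs → ¬ ¬ All P xs
¬¬-All []       k = k []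
¬¬-All (p ∷ ps) k = p λ px → ¬¬-All ps λ pxs → k (px ∷ pxs)

¬¬-AllPairs : ∀ {X : Set} {R : Rel X 0ℓ} {xs} → AllPairs (λ x y → ¬ ¬ R x y) xs → ¬ ¬ AllPairs R xs
¬¬-AllPairs []       k = k []
¬¬-AllPairs (r ∷ rs) k = ¬¬-All r λ rx → ¬¬-AllPairs rs λ rxs → k (rx ∷ rxs)

-- Asking for all smaller `δ` and all later `n` lets finitely many such statements be combined, by a
-- minimum of thresholds and a maximum of indices.
Uniformly : (ℚ → ℕ → Set) → Set
Uniformly Q = ∃ λ ε → ∃ λ N → 0ℚ < ε × (∀ δ n → δ ≤ ε → N ℕ.≤ n → Q δ n)

⊓-pos : ∀ {p q} → 0ℚ < p → 0ℚ < q → 0ℚ < p ⊓ q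
⊓-pos {p} {q} 0<p 0<q = case ⊓-sel p q of λ where
  (inj₁ eq) → subst (0ℚ <_) (sym eq) 0<p
  (inj₂ eq) → subst (0ℚ <_) (sym eq) 0<q

uniformly-both : ∀ {Q₁ Q₂ Q : ℚ → ℕ → Set} → (∀ {δ n} → Q₁ δ n → Q₂ δ n → Q δ n) →
                 Uniformly Q₁ → Uniformly Q₂ → Uniformly Q
uniformly-both f (ε₁ , N₁ , 0<ε₁ , q₁) (ε₂ , N₂ , 0<ε₂ , q₂) =
  ε₁ ⊓ ε₂ , N₁ ℕ.⊔ N₂ , ⊓-pos 0<ε₁ 0<ε₂ , λ δ n δ≤ N≤n → f
    (q₁ δ n (≤-trans δ≤ (p⊓q≤p ε₁ ε₂)) (ℕₚ.m⊔n≤o⇒m≤o N₁ N₂ N≤n))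
    (q₂ δ n (≤-trans δ≤ (p⊓q≤q ε₁ ε₂)) (ℕₚ.m⊔n≤o⇒n≤o N₁ N₂ N≤n))

Far : ℚ → ℕ → Rel ℂ 0ℓ
Far δ n z w = δ ≤ ‖ at n z ⊝ at n w ‖

uniformly-far : ∀ {xs} → AllPairs EventuallyApartᶜ xs → Uniformly λ δ n → AllPairs (Far δ n) xs
uniformly-far []                 = 1ℚ , 0 , positive⁻¹ 1ℚ , λ _ _ _ _ → []
uniformly-far {z ∷ _} (r ∷ rs) = uniformly-both _∷_ (row r) (uniformly-far rs)
  where
  row : ∀ {ys} → All (EventuallyApartᶜ z) ys → Uniformly λ δ n → All (Far δ n z) ys
  row []                          = 1ℚ , 0 , positive⁻¹ 1ℚ , λ _ _ _ _ → []
  row ((ε , N , 0<ε , far) ∷ as) = uniformly-both _∷_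
    (ε , N , 0<ε , λ δ n δ≤ε N≤n → ≤-trans δ≤ε (far n N≤n)) (row as)

SettledByᶜ : ℚ → ℕ → ℂ → Set
SettledByᶜ δ N z = SettledBy δ N (re z) × SettledBy δ N (im z)

eventually-settled : ∀ {δ} → 0ℚ < δ → ∀ zs → ∃ λ N → ∀ n → N ℕ.≤ n → All (SettledByᶜ δ n) zs
eventually-settled 0<δ []       = 0 , λ _ _ → []
eventually-settled {δ} 0<δ (z ∷ zs) =
  let N₁ , p = cauchy (re z) δ 0<δ
      N₂ , q = cauchy (im z) δ 0<δ
      N₃ , r = eventually-settled 0<δ zs
  in (N₁ ℕ.⊔ N₂) ℕ.⊔ N₃ , λ n h →
    let h₁₂ = ℕₚ.m⊔n≤o⇒m≤o (N₁ ℕ.⊔ N₂) N₃ h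
        h₁ = ℕₚ.m⊔n≤o⇒m≤o N₁ N₂ h₁₂
        h₂ = ℕₚ.m⊔n≤o⇒n≤o N₁ N₂ h₁₂
    in ((λ k l n≤k n≤l → p k l (ℕₚ.≤-trans h₁ n≤k) (ℕₚ.≤-trans h₁ n≤l)) ,
        (λ k l n≤k n≤l → q k l (ℕₚ.≤-trans h₂ n≤k) (ℕₚ.≤-trans h₂ n≤l))) ∷
       r n (ℕₚ.m⊔n≤o⇒n≤o (N₁ ℕ.⊔ N₂) N₃ h)

-- Far out the sequences are within `δ` of each other, and each has moved by less than `δ` since
-- `N`.
≈ᴿ⇒near : ∀ {δ N x y} → 0ℚ < δ → SettledBy δ N x → SettledBy δ N y → x ≈ᴿ y →
          ∣ seq x N - seq y N ∣ ≤ δ + (δ + δ)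
≈ᴿ⇒near {δ} {N} {x} {y} 0<δ sx sy x≈y =
  let M , p = close x≈y δ 0<δ
  in <⇒≤ (<-trans (settled-distance x y sx sy N (N ℕ.⊔ M) ℕₚ.≤-refl (ℕₚ.m≤m⊔n N M))
       (+-monoˡ-< (δ + δ) (p (N ℕ.⊔ M) (ℕₚ.m≤n⊔m N M))))

≈ᶜ⇒near : ∀ {δ N z w} → 0ℚ < δ → SettledByᶜ δ N z → SettledByᶜ δ N w → z ≈ᶜ w →
          ‖ at N z ⊝ at N w ‖ ≤ δ + (δ + δ)
≈ᶜ⇒near 0<δ (sre , sim) (sre′ , sim′) z≈w = ⊔-lub
  (≈ᴿ⇒near 0<δ sre sre′ (re-≈ z≈w)) (≈ᴿ⇒near 0<δ sim sim′ (im-≈ z≈w))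

-- Finite enumeration of the values.

tuples : ∀ {X : Set} n → List X → List (Vec X n)
tuples zero    xs = [] ∷ []
tuples (suc n) xs = cartesianProductWith _∷_ xs (tuples n xs)

∈-tuples : ∀ {X : Set} {n} {xs : List X} {s : Vec X n} → VecAll.All (_∈ xs) s → s ∈ tuples n xs
∈-tuples VecAll.[]       = here refl
∈-tuples (p VecAll.∷ ps) = ∈-cartesianProductWith⁺ _∷_ p (∈-tuples ps)

tuples-within : ∀ {X : Set} n (xs : List X) → All (VecAll.All (_∈ xs)) (tuples n xs)
tuples-within zero    xs = VecAll.[] ∷ []
tuples-within (suc n) xs =
  All-cartesianProductWith _∷_ VecAll._∷_ (All.tabulate (λ x∈ → x∈)) (tuples-within n xs)

module _ (S : Setoid 0ℓ 0ℓ) where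
  open Setoid S renaming (refl to ≈-refl; sym to ≈-sym; trans to ≈-trans)
  open Membership S using () renaming (_∈_ to _∈ˢ_)
  open UniqueSetoid S using (Unique)

  -- Equality in `S` need not be decidable, so whether an element repeats is settled by excluded
  -- middle under a double negation, once per element.
  deduplicate : ∀ zs → ¬ ¬ ∃ λ ys → Unique ys × (∀ z → z ∈ˢ zs ⇔ z ∈ˢ ys)
  deduplicate []       k = k ([] , [] , λ z → mk⇔ (λ p → p) (λ p → p))
  deduplicate (w ∷ zs) k = deduplicate zs λ (ys , unique , eq) →
    ¬¬-excluded-middle {A = w ∈ˢ ys} λ where
      (yes w∈ys) → k (ys , unique , λ z → mk⇔
        (λ { (here z≈w) → Membershipₚ.∈-resp-≈ S (≈-sym z≈w) w∈ys
           ; (there z∈) → Equivalence.to (eq z) z∈ })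
        (there ∘ Equivalence.from (eq z)))
      (no w∉ys) → k (w ∷ ys , Allₚ.¬Any⇒All¬ ys w∉ys ∷ unique , λ z → mk⇔
        (λ { (here z≈w) → here z≈w ; (there z∈) → there (Equivalence.to (eq z) z∈) })
        (λ { (here z≈w) → here z≈w ; (there z∈) → there (Equivalence.from (eq z) z∈) }))

  lookup-injective : ∀ {xs} → Unique xs → ∀ i j → List.lookup xs i ≈ List.lookup xs j → i ≡ j
  lookup-injective (_ ∷ _)  fzero    fzero    _  = refl
  lookup-injective (r ∷ _)  fzero    (fsuc j) eq = contradiction eq (All.lookup r (∈-lookup j))
  lookup-injective (r ∷ _)  (fsuc i) fzero    eq = contradiction (≈-sym eq) (All.lookup r (∈-lookup i))
  lookup-injective (_ ∷ rs) (fsuc i) (fsuc j) eq = cong fsuc (lookup-injective rs i j eq)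

  -- The position at which an element is found in `ys` is an injective function of its position in
  -- `xs`.
  unique⇒length-≤ : ∀ {xs ys} → Unique xs → (∀ {x} → x ∈ xs → x ∈ˢ ys) → length xs ℕ.≤ length ys
  unique⇒length-≤ {xs} unique sub = Finₚ.injective⇒≤ {f = λ i → Any.index (sub (∈-lookup i))}
    λ {i} {j} eq → lookup-injective unique i j (
      Membershipₚ.index-injective S (sub (∈-lookup i)) (sub (∈-lookup j)) eq)

  ∈⇒∈ˢ : ∀ {x xs} → x ∈ xs → x ∈ˢ xs
  ∈⇒∈ˢ = Any.map λ { refl → ≈-refl }

  -- Coordinates taken from `A` equal listed elements only up to `_≈_`; replacing them by those
  -- elements is where `F-cong` enters.
  image-list : ∀ {k} (F : Vector Carrier k → Carrier) →
    (∀ x y → (∀ j → x j ≈ y j) → F x ≈ F y) →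
    ∀ {A : Pred Carrier 0ℓ} xs → (∀ z → A z ⇔ z ∈ˢ xs) →
    ∀ z → (∃ λ x → (∀ j → A (x j)) × z ≈ F x) ⇔ z ∈ˢ map (F ∘ Vec.lookup) (tuples k xs)
  image-list {k} F F-cong {A} xs A⇔ z = mk⇔ to from
    where
    to : _ → _
    to (x , Ax , z≈) = Any.map (λ { refl → ≈-trans z≈ (F-cong x (Vec.lookup s) x≈s) })
      (∈-map⁺ (F ∘ Vec.lookup) (∈-tuples (VecAllₚ.tabulate⁺ (λ j → proj₁ (proj₂ (chosen j))))))
      where
      chosen : ∀ j → ∃ λ y → y ∈ xs × x j ≈ y
      chosen j = find (Equivalence.to (A⇔ (x j)) (Ax j))
      s : Vec Carrier k
      s = Vec.tabulate (λ j → proj₁ (chosen j))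
      x≈s : ∀ j → x j ≈ Vec.lookup s j
      x≈s j = subst (x j ≈_) (sym (lookup∘tabulate (λ j → proj₁ (chosen j)) j)) (proj₂ (proj₂ (chosen j)))

    from : _ → _
    from z∈ =
      let w , w∈ , z≈w = find z∈
          s , s∈ , w≡ = ∈-map⁻ (F ∘ Vec.lookup) w∈
          within = All.lookup (tuples-within k xs) s∈
      in Vec.lookup s ,
         (λ j → Equivalence.from (A⇔ _) (∈⇒∈ˢ (VecAllₚ.lookup⁺ within j))) ,
         subst (z ≈_) w≡ z≈w

-- Numerical constants of the count.

small-square : ∀ {η} → 0ℚ < η → ∃ λ δ → 0ℚ < δ ×
  4ℚ * (2ℚ * ((δ + (δ + δ)) * (δ + (δ + δ)))) < η
-- With δ = m / 16 the left side is 9/32 of the square of `m`. Since `m` is the minimum of 1 and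
-- `η`, that square is at most `m`, hence at most `η`.
small-square {η} 0<η = r * m , *-pos (positive⁻¹ r) 0<m ,
  <-≤-trans
    (subst₂ _<_
      (solve 1 (λ m → con (+ 9 / 32) :* (m :* m)
        := con 4ℚ :* (con 2ℚ :* ((con r :* m :+ (con r :* m :+ con r :* m))
                                 :* (con r :* m :+ (con r :* m :+ con r :* m))))) refl m)
      (*-identityˡ (m * m))
      (*-monoˡ-<-pos (m * m) {{positive (*-pos 0<m 0<m)}} (from-yes (+ 9 / 32 <? 1ℚ))))
    (≤-trans (*-monoʳ-≤ (<⇒≤ 0<m) (p⊓q≤p 1ℚ η))
      (subst (_≤ η) (sym (*-identityˡ m)) (p⊓q≤q 1ℚ η)))
  where
  m r : ℚ
  m = 1ℚ ⊓ η
  r = + 1 / 16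
  0<m : 0ℚ < m
  0<m = ⊓-pos (positive⁻¹ 1ℚ) 0<η

reciprocal : ∀ D → 1 ℕ.≤ D → ∃ λ c → 0ℚ < c × (∀ {x m} → x ℕ.≤ D ℕ.* m → c * ℕ→ℚ x ≤ ℕ→ℚ m)
reciprocal D 1≤D = 1/ d , positive⁻¹ (1/ d) {{1/pos⇒pos d}} , λ {x} {m} x≤ →
  subst (1/ d * ℕ→ℚ x ≤_)
    (trans (sym (*-assoc (1/ d) d (ℕ→ℚ m)))
      (trans (cong (_* ℕ→ℚ m) (*-inverseˡ d)) (*-identityˡ (ℕ→ℚ m))))
    (*-monoˡ-≤ (<⇒≤ (positive⁻¹ (1/ d) {{1/pos⇒pos d}}))
      (subst (ℕ→ℚ x ≤_) (ℕ→ℚ-* D m) (ℕ→ℚ-mono x≤)))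
  where
  d : ℚ
  d = ℕ→ℚ D
  instance
    d-pos : Positive d
    d-pos = positive (<-≤-trans (positive⁻¹ 1ℚ) (ℕ→ℚ-mono 1≤D))
    d-nonZero : NonZero d
    d-nonZero = pos⇒nonZero d

^-distribʳ-* : ∀ a b n → (a ℕ.* b) ℕ.^ n ≡ a ℕ.^ n ℕ.* b ℕ.^ n
^-distribʳ-* a b zero    = refl
^-distribʳ-* a b (suc n) = trans (cong (a ℕ.* b ℕ.*_) (^-distribʳ-* a b n))
  (ℕₚ.[m*n]*[o*p]≡[m*o]*[n*p] a b (a ℕ.^ n) (b ℕ.^ n))

-- The length less one is divided by `suc n`, the one being the spare element after the last block.
-- The quotient is at least 1, so rounding down costs at most a factor 2.
block-size : ∀ n a → suc n ℕ.< a → ∃ λ q →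
  suc n ℕ.* q ℕ.+ 1 ℕ.≤ a × a ℕ.≤ (suc n ℕ.+ suc n) ℕ.* q
block-size n (suc a) (ℕ.s≤s n<a) = q , fits , covers q (m≡m%n+[m/n]*n a (suc n))
  where
  q r : ℕ
  q = a ℕ./ suc n
  r = a ℕ.% suc n

  fits : suc n ℕ.* q ℕ.+ 1 ℕ.≤ suc a
  fits = subst (ℕ._≤ suc a) (ℕₚ.+-comm 1 (suc n ℕ.* q)) (ℕ.s≤s
    (subst₂ ℕ._≤_ (ℕₚ.*-comm q (suc n)) (sym (m≡m%n+[m/n]*n a (suc n))) (ℕₚ.m≤n+m _ r)))

  covers : ∀ q → a ≡ r ℕ.+ q ℕ.* suc n → suc a ℕ.≤ (suc n ℕ.+ suc n) ℕ.* q
  covers zero    eq = contradiction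
    (subst (ℕ._< suc n) (sym (trans eq (ℕₚ.+-identityʳ r))) (m%n<n a (suc n))) (ℕₚ.≤⇒≯ n<a)
  covers (suc q) eq = subst₂ ℕ._≤_ (cong suc (sym eq)) (sym (ℕₚ.*-distribʳ-+ (suc q) (suc n) (suc n)))
    (ℕₚ.+-mono-≤ (ℕₚ.≤-trans (m%n<n a (suc n)) (ℕₚ.m≤m*n (suc n) (suc q)))
      (ℕₚ.≤-reflexive (ℕₚ.*-comm (suc q) (suc n))))

1≤loss : ∀ n → 1 ℕ.≤ loss n
1≤loss zero    = ℕₚ.≤-refl
1≤loss (suc n) = ℕₚ.*-mono-≤ {1} {suc (grid-ratio n) ℕ.* suc (grid-ratio n)} (ℕ.s≤s ℕ.z≤n) (1≤loss n)

-- The power comes from passing from the length of the list to the block size, and `loss n` from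
-- thinning.
denominator : ℕ → ℕ
denominator n = (n ℕ.+ n) ℕ.^ n ℕ.* loss n

-- Distinctness of the complex values.

open Membership ℂ-setoid using () renaming (_∈_ to _∈ᶜ_)
open UniqueSetoid ℂ-setoid using (Unique)

module _ {n : ℕ} (F : Vec ℂ (2 ℕ.+ n) → ℂ) (at-F : ∀ k s → at k (F s) ≡ value (at k) s) where

  module _ {N : ℕ} {δ η : ℚ} (0<δ : 0ℚ < δ)
           (small : 4ℚ * (2ℚ * ((δ + (δ + δ)) * (δ + (δ + δ)))) < η) where

    -- Equal values would lie within 3 δ of each other at index `N`, and `small` says that this is
    -- too close for the separation `η`.
    separated⇒≉ : ∀ s t → SettledByᶜ δ N (F s) → SettledByᶜ δ N (F t) →
      η ≤ 4ℚ * norm² (value (at N) s ⊝ value (at N) t) → ¬ (F s ≈ᶜ F t)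
    separated⇒≉ s t settled-s settled-t η≤ s≈t =
      <-irrefl refl (≤-<-trans (≤-trans η≤ (*-monoˡ-≤ (0≤ℕ→ℚ 4)
        (≤-trans (norm²≤2‖‖² d) (*-monoˡ-≤ 0≤2ℚ (square-mono (‖‖-nonneg d) near))))) small)
      where
      d : ℚ[i]
      d = value (at N) s ⊝ value (at N) t
      near : ‖ d ‖ ≤ δ + (δ + δ)
      near = subst (λ z → ‖ z ‖ ≤ δ + (δ + δ)) (cong₂ _⊝_ (at-F N s) (at-F N t))
        (≈ᶜ⇒near {δ} {N} {F s} {F t} 0<δ settled-s settled-t s≈t)

    unique-values : ∀ T → All (λ s → SettledByᶜ δ N (F s)) T →
      AllPairs (λ s t → η ≤ 4ℚ * norm² (value (at N) s ⊝ value (at N) t)) T →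
      Unique (map F T)
    unique-values T settled sep = AllPairsₚ.map⁺
      (AllPairs-strengthen (λ {s} {t} → separated⇒≉ s t) settled sep)

  many-values : ∀ q xs → Unique xs → 2 ℕ.≤ length xs → n ℕ.* q ℕ.+ 1 ℕ.≤ length xs →
    ¬ ¬ ∃ λ (T : List (Vec ℂ (2 ℕ.+ n))) → All (VecAll.All (_∈ xs)) T ×
      Unique (map F T) × q ℕ.^ n ℕ.≤ loss n ℕ.* length T
  many-values q xs unique 2≤ le k =
    ¬¬-AllPairs (AllPairs.map (λ {z} {w} → ≉⇒¬¬apart {z} {w}) unique) (k ∘ select)
    where
    select : AllPairs EventuallyApartᶜ xs → ∃ λ (T : List (Vec ℂ (2 ℕ.+ n))) →
      All (VecAll.All (_∈ xs)) T × Unique (map F T) × q ℕ.^ n ℕ.≤ loss n ℕ.* length T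
    select apart =
      let ε , N₁ , 0<ε , far = uniformly-far apart
          -- `separated-values` asks for a gap of `g + g`.
          g = ½ * ε
          0<g = half-pos 0<ε
          δ , 0<δ , small = small-square (^ℚ-pos n (*-pos 0<g 0<g))
          -- The selected tuples `T` depend on the index. To avoid circularity, the values at all
          -- tuples over `xs` are settled before `T` is chosen; `δ` depends only on `ε` and `n`.
          N₂ , settle = eventually-settled 0<δ (map F (tuples (2 ℕ.+ n) xs))
          N = N₁ ℕ.⊔ N₂
          settled = settle N (ℕₚ.m≤n⊔m N₁ N₂)
          T , within , sep , q^n≤ = separated-values (at N) 0<g n q xs
            (AllPairs.map (λ {z} {w} → subst (_≤ ‖ at N z ⊝ at N w ‖) (sym (½ε+½ε≡ε ε)))
              (far ε N ≤-refl (ℕₚ.m≤m⊔n N₁ N₂)))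
            2≤ le
          inside = within (All.tabulate (λ x∈ → x∈))
      in T , inside ,
        unique-values {N} {δ} 0<δ small T
          (All.map (λ p → All.lookup settled (∈-map⁺ F (∈-tuples p))) inside) sep ,
        q^n≤

-- Counting the values.

-- For a ≤ n + 1 the bound only says that some value exists.
few-elements : ∀ n a m → a ℕ.≤ suc n → (1 ℕ.≤ a → 1 ℕ.≤ m) →
               a ℕ.^ suc n ℕ.≤ denominator (suc n) ℕ.* m
few-elements n zero    m _  _        = ℕ.z≤n
few-elements n (suc a) m le nonempty = ℕₚ.≤-trans
  (ℕₚ.^-monoˡ-≤ (suc n) (ℕₚ.≤-trans le (ℕₚ.m≤m+n (suc n) (suc n))))
  (subst (ℕ._≤ denominator (suc n) ℕ.* m)
    (trans (ℕₚ.*-identityʳ _) (ℕₚ.*-identityʳ _))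
    (ℕₚ.*-mono-≤ (ℕₚ.*-monoʳ-≤ ((suc n ℕ.+ suc n) ℕ.^ suc n) (1≤loss (suc n))) (nonempty (ℕ.s≤s ℕ.z≤n))))

value-count : ∀ n (F : Vec ℂ (2 ℕ.+ suc n) → ℂ) → (∀ k s → at k (F s) ≡ value (at k) s) →
  ∀ xs ys → Unique xs → (∀ z → z ∈ᶜ map F (tuples (2 ℕ.+ suc n) xs) → z ∈ᶜ ys) →
  ¬ ¬ (length xs ℕ.^ suc n ℕ.≤ denominator (suc n) ℕ.* length ys)
value-count n F at-F xs ys unique sub k = by (length xs ℕₚ.≤? suc n)
  where
  values : List ℂ
  values = map F (tuples (2 ℕ.+ suc n) xs)

  value∈ : ∀ {s} → VecAll.All (_∈ xs) s → F s ∈ᶜ ys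
  value∈ {s} p = sub (F s) (∈⇒∈ˢ ℂ-setoid (∈-map⁺ F (∈-tuples p)))

  nonempty : ∀ zs → (∀ {x} → x ∈ zs → x ∈ xs) → 1 ℕ.≤ length zs → 1 ℕ.≤ length ys
  nonempty (z ∷ _) inc _ = ∈ᶜ⇒nonempty (value∈ (VecAllₚ.tabulate⁺ {f = λ _ → z} (λ _ → inc (here refl))))
    where
    ∈ᶜ⇒nonempty : ∀ {w ws} → w ∈ᶜ ws → 1 ℕ.≤ length ws
    ∈ᶜ⇒nonempty (here _)  = ℕ.s≤s ℕ.z≤n
    ∈ᶜ⇒nonempty (there _) = ℕ.s≤s ℕ.z≤n

  D L : ℕ
  D = (suc n ℕ.+ suc n) ℕ.^ suc n
  L = loss (suc n)

  bound : ∀ {q} T → All (VecAll.All (_∈ xs)) T → Unique (map F T) →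
    q ℕ.^ suc n ℕ.≤ L ℕ.* length T → length xs ℕ.≤ (suc n ℕ.+ suc n) ℕ.* q →
    length xs ℕ.^ suc n ℕ.≤ denominator (suc n) ℕ.* length ys
  bound {q} T inside unique-T q^n≤ covers =
    ℕₚ.≤-trans (ℕₚ.^-monoˡ-≤ (suc n) covers)
    (ℕₚ.≤-trans (ℕₚ.≤-reflexive (^-distribʳ-* (suc n ℕ.+ suc n) q (suc n)))
    (ℕₚ.≤-trans (ℕₚ.*-monoʳ-≤ D q^n≤)
    (ℕₚ.≤-trans (ℕₚ.≤-reflexive (sym (ℕₚ.*-assoc D L (length T))))
    (ℕₚ.*-monoʳ-≤ (D ℕ.* L) (subst (ℕ._≤ length ys) (length-map F T)
      (unique⇒length-≤ ℂ-setoid unique-T T⊆ys))))))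
    where
    T⊆ys : ∀ {w} → w ∈ map F T → w ∈ᶜ ys
    T⊆ys w∈ =
      let s , s∈ , w≡ = ∈-map⁻ F w∈
      in subst (_∈ᶜ ys) (sym w≡) (value∈ (All.lookup inside s∈))

  by : Dec (length xs ℕ.≤ suc n) → _
  by (yes few) = k (few-elements n (length xs) (length ys) few (nonempty xs (λ p → p)))
  by (no many) =
    let q , fits , covers = block-size n (length xs) (ℕₚ.≰⇒> many)
    in many-values F at-F q xs unique (ℕₚ.≤-trans (ℕ.s≤s (ℕ.s≤s ℕ.z≤n)) (ℕₚ.≰⇒> many)) fits
      λ (T , inside , unique-T , q^n≤) → k (bound {q} T inside unique-T q^n≤ covers)

-- Stated for an opaque F: unfolding P in the proof below would be prohibitively slow.
cardinality-bound : ∀ n (F : Vector ℂ (2 ℕ.+ suc n) → ℂ) →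
  (∀ x y → (∀ j → x j ≈ᶜ y j) → F x ≈ᶜ F y) →
  HasHornerForm (suc n) F →
  ∃ λ (c : ℚ) → 0ℚ < c ×
  (∀ (A : Pred ℂ 0ℓ) (a : ℕ) → HasCardinality ℂ-setoid A a →
  ¬ ¬ (∃ λ (m : ℕ) →
    HasCardinality ℂ-setoid (λ z → ∃ λ x → (∀ j → A (x j)) × z ≈ᶜ F x) m ×
    c * ℕ→ℚ (a ℕ.^ suc n) ≤ ℕ→ℚ m))
cardinality-bound n F F-cong at-F = c , 0<c , count
  where
  constant : ∃ λ c → 0ℚ < c × (∀ {x m} → x ℕ.≤ denominator (suc n) ℕ.* m → c * ℕ→ℚ x ≤ ℕ→ℚ m)
  constant = reciprocal (denominator (suc n))
    (ℕₚ.*-mono-≤ (ℕₚ.m^n>0 (suc n ℕ.+ suc n) (suc n)) (1≤loss (suc n)))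
  c : ℚ
  c = proj₁ constant
  0<c : 0ℚ < c
  0<c = proj₁ (proj₂ constant)

  count : ∀ (A : Pred ℂ 0ℓ) (a : ℕ) → HasCardinality ℂ-setoid A a →
    ¬ ¬ (∃ λ (m : ℕ) →
      HasCardinality ℂ-setoid (λ z → ∃ λ x → (∀ j → A (x j)) × z ≈ᶜ F x) m ×
      c * ℕ→ℚ (a ℕ.^ suc n) ≤ ℕ→ℚ m)
  count A _ (xs , unique , refl , A⇔) k =
    -- The list of all values may repeat up to `_≈ᶜ_`; the length of its repetition-free form `ys`
    -- is the cardinality.
    deduplicate ℂ-setoid (map (F ∘ Vec.lookup) (tuples (2 ℕ.+ suc n) xs))
      λ (ys , unique-ys , same) →
      value-count n (F ∘ Vec.lookup) at-F xs ys unique (λ z → Equivalence.to (same z)) λ le →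
        k (length ys ,
          (ys , unique-ys , refl , λ z →
            same z ⇔-∘ image-list ℂ-setoid F F-cong xs A⇔ z) ,
          proj₂ (proj₂ constant) {length xs ℕ.^ suc n} {length ys} le)

theorem1 : ∀ (n : ℕ) → 2 ℕ.≤ n →
    ∃ λ (c : ℚ) → 0ℚ < c ×
    (∀ (A : Pred ℂ 0ℓ) (a : ℕ) → HasCardinality ℂ-setoid A a →
    ¬ ¬ (∃ λ (m : ℕ) → HasCardinality ℂ-setoid (Values n A) m ×
    c * ℕ→ℚ (a ℕ.^ n) ≤ ℕ→ℚ m))
theorem1 (suc n) _ = cardinality-bound n (P ℂ-rawRing (suc n)) (P-cong (suc n)) (P-horner (suc n))
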